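{- Let $k$ be a positive integer. There exist polynomials $A(n,d), B(n,d)$ in $n$ of degree at most $2k$, whose coefficients are rational functions of $d$, such that $$\sum_{\lambda\in \mathcal{C}_{n,dn+1}}|\lambda|^k = A(n,d)\, M_d(n) + B(n,d)\, M_d(n+1).$$ Likewise, there exist polynomials $A'(n,d), B'(n,d)$ in $n$ of degree at most $2k$, with coefficients rational functions of $d$, such that $$\sum_{\lambda\in \mathcal{C}_{n,dn-1}}|\lambda|^k = A'(n,d)\, M_d(n) + B'(n,d)\, M_d(n+1).$$
   Context: A partition $\lambda=(\lambda_1\ge\dots\ge\lambda_\ell)$ has size $|\lambda|=\sum_i\lambda_i$. The hook length of a box $(i,j)$ of its Young diagram is the number of boxes directly to its right, directly below it, plus the box itself. For a positive integer $t$, $\lambda$ is a $t$-core if none of its hook lengths is divisible by $t$; it is an $(s,t)$-core if it is both an $s$-core and a $t$-core. For positive integers $n,d$, $\mathcal{C}_{n,dn+1}$ (resp. $\mathcal{C}_{n,dn-1}$) denotes the (finite) set of $(n,dn+1)$-core (resp. $(n,dn-1)$-core) partitions with distinct parts. The sequence $M_d(n)$ is defined by $M_d(-1)=0$, $M_d(0)=1$, $M_d(n)=M_d(n-1)+dM_d(n-2)$ for $n\ge1$. -}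

module Defs where

open import Data.Nat as ℕ using (ℕ; zero; suc; _∸_; _≤_; _<_; _≤?_; _^_)
open import Data.Nat.Divisibility using (_∣_)
open import Data.Integer using (+_)
open import Data.Rational as ℚ using (ℚ; 0ℚ; 1ℚ; _/_; 1/_; ≢-nonZero)
open import Data.List using (List; []; _∷_; map; filter; length; upTo; _++_)
open import Data.Nat.ListAction using (sum)
open import Data.List.Relation.Unary.All using (All)
open import Data.List.Relation.Unary.Linked using (Linked)
open import Data.Vec using (Vec; []; _∷_)
import Data.Vec.Relation.Unary.All as VAll
open import Relation.Nullary using (¬_)
open import Relation.Binary.PropositionalEquality using (_≢_)

-- Partitions are lists of parts λ₁ ≥ λ₂ ≥ … ≥ λ_ℓ > 0.

DistinctParts : List ℕ → Set
DistinctParts p = Linked ℕ._>_ p × All (0 <_) p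
  where open import Data.Product using (_×_)

size : List ℕ → ℕ
size = sum

colLen : ℕ → List ℕ → ℕ
colLen j p = length (filter (j ≤?_) p)

-- hook length of box (i,j) (1-indexed) is (λ_i - j) + (λ'_j - i) + 1.
-- hooksFrom i rs p lists the hook lengths of the boxes in rows i, i+1, …
-- where rs are the parts λ_i, λ_{i+1}, … of the full partition p.
hooksFrom : ℕ → List ℕ → List ℕ → List ℕ
hooksFrom i []       p = []
hooksFrom i (r ∷ rs) p =
  map (λ j → suc ((r ∸ j) ℕ.+ (colLen j p ∸ i))) (map suc (upTo r))
  ++ hooksFrom (suc i) rs p

hooks : List ℕ → List ℕ
hooks p = hooksFrom 1 p p

IsCore : ℕ → List ℕ → Set
IsCore t p = All (λ h → ¬ (t ∣ h)) (hooks p)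

InC : ℕ → ℕ → List ℕ → Set
InC s t p = DistinctParts p × IsCore s p × IsCore t p
  where open import Data.Product using (_×_)

sumPow : ℕ → List (List ℕ) → ℕ
sumPow k L = sum (map (λ p → size p ^ k) L)

-- M_d(n): M_d(-1)=0, M_d(0)=1, M_d(n)=M_d(n-1)+d M_d(n-2); so M_d(1)=1
M : ℕ → ℕ → ℕ
M d zero = 1
M d (suc zero) = 1
M d (suc (suc n)) = M d (suc n) ℕ.+ d ℕ.* M d n

toℚ : ℕ → ℚ
toℚ n = (+ n) / 1

evalPoly : List ℚ → ℚ → ℚ
evalPoly []       x = 0ℚ
evalPoly (c ∷ cs) x = c ℚ.+ x ℚ.* evalPoly cs x

record RatFun : Set where
  constructor _⁄_
  field
    num : List ℚ
    den : List ℚ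
open RatFun public

DefinedAt : ℚ → RatFun → Set
DefinedAt d r = evalPoly (den r) d ≢ 0ℚ

evalRF : (r : RatFun) (d : ℚ) → DefinedAt d r → ℚ
evalRF r d ne = evalPoly (num r) d ℚ.* (1/ evalPoly (den r) d) {{≢-nonZero ne}}

-- polynomial in n of degree ≤ m-1 whose coefficients are rational functions of d:
-- A(n,d) = Σ_i c_i(d) n^i, given as the vector (c₀, …, c_{m-1})
PolyRF : ℕ → Set
PolyRF m = Vec RatFun m

AllDefinedAt : ∀ {m} → ℚ → PolyRF m → Set
AllDefinedAt d A = VAll.All (DefinedAt d) A

evalPolyRF : ∀ {m} (A : PolyRF m) (n d : ℚ) → AllDefinedAt d A → ℚ
evalPolyRF []      n d VAll.[]         = 0ℚ
evalPolyRF (c ∷ A) n d (dc VAll.∷ dA) = evalRF c d dc ℚ.+ n ℚ.* evalPolyRF A n d dA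

module Submission where

-- The beta-set (first-column hook lengths) of a partition with distinct parts omits 0 and contains no two consecutive
-- numbers, and the partition is a t-core iff its beta-set is closed under subtracting t. For an (n, dn ± 1)-core this forces
-- all elements below dn, so that the beta-set is a choice of numbers a_i ≤ d, i < n, of elements in the residue classes
-- modulo n, with a₀ = 0, no two adjacent a_i nonzero, and a_{n−1} < d in the case dn − 1. The size of the partition is
-- Σ i a_i + n Σ C(a_i,2) − C(Σ a_i,2).
--
-- Prepending entries to a word of a_i's translates these three statistics and the length. Give Σ i a_i the weight 2 and the
-- others the weight 1: then a translation changes a polynomial in the statistics by one of smaller weight. Hence the
-- sum over all words of a polynomial of weight w satisfies the recurrence of M_d up to a sum for weight w − 1, and solving
-- this recurrence raises the degree in n by one; the only denominators are d and the discriminant 1 + 4d of x² − x − d.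

open import Defs
open import Data.Nat as ℕ using (ℕ; zero; suc; pred)
import Data.Nat.Properties as ℕₚ
open import Data.Nat.Combinatorics using (_C_; nC1≡n; nCk+nC[k+1]≡[n+1]C[k+1]; k>n⇒nCk≡0)
open import Data.Nat.ListAction using (sum)
import Data.Integer as ℤ
import Data.Integer.Properties as ℤₚ
open import Data.Rational as ℚ using (ℚ; 0ℚ; 1ℚ; ½; 1/_; ≢-nonZero)
import Data.Rational.Properties as ℚₚ
import Data.Rational.Unnormalised as ℚᵘ
import Data.Rational.Unnormalised.Properties as ℚᵘₚ
open import Data.Rational.Solver using () renaming (module +-*-Solver to ℚ-Solver)
open import Data.Product using (Σ; ∃; _×_; _,_; proj₁; proj₂)
open import Data.List using (List; []; _∷_; map; _++_; length; upTo)
open import Data.List.Relation.Unary.All as All using (All; []; _∷_)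
import Data.List.Relation.Unary.All.Properties as Allₚ
open import Data.Vec using ([]; _∷_)
import Data.Vec.Relation.Unary.All as VAll
open import Relation.Binary.PropositionalEquality

-- The bound 2k is a weight count. Each monomial of the size weighs at most 2, so its k-th power
-- weighs at most 2k, and every unit of weight costs one degree in n. The moment Σ i a_i has weight
-- 2 because an entry placed at position i changes it by i times that entry, a multiple of the
-- variable counting the length.
--
-- The degree goes up at each step because the equation is resonant: the corrections are themselves
-- polynomials in n times solutions of the homogeneous recurrence. With S the shift on those
-- solutions, removing a leading term means inverting S + 2d = S (2S - 1). The factors S and 2S - 1
-- have norms -d and -(1 + 4d), which is where both denominators come from; neither vanishes for d ≥
-- 1.
--
-- One formula has to serve all d at once, while the number of choices for an entry grows with d.
-- Sums over entries therefore need a closed form in d, and every coefficient has to carry an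
-- explicit fraction with its denominator nonzero at each d ≥ 1.

toℚ-+ : ∀ a b → toℚ (a ℕ.+ b) ≡ toℚ a ℚ.+ toℚ b
toℚ-+ a b = sym (ℚₚ.toℚᵘ-injective (begin
  ℚ.toℚᵘ (toℚ a ℚ.+ toℚ b)                  ≈⟨ ℚₚ.toℚᵘ-homo-+ (toℚ a) (toℚ b) ⟩
  ℚ.toℚᵘ (toℚ a) ℚᵘ.+ ℚ.toℚᵘ (toℚ b)         ≈⟨ ℚᵘₚ.+-cong (ℚₚ.toℚᵘ-fromℚᵘ a′) (ℚₚ.toℚᵘ-fromℚᵘ b′) ⟩
  a′ ℚᵘ.+ b′                                ≈⟨ ℚᵘ.*≡* (cong (ℤ._* ℤ.1ℤ) (cong₂ ℤ._+_ (ℤₚ.*-identityʳ (ℤ.+ a)) (ℤₚ.*-identityʳ (ℤ.+ b)))) ⟩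
  ℚᵘ.mkℚᵘ (ℤ.+ (a ℕ.+ b)) 0                 ≈⟨ ℚₚ.toℚᵘ-fromℚᵘ _ ⟨
  ℚ.toℚᵘ (toℚ (a ℕ.+ b))                    ∎))
  where
  open ℚᵘₚ.≃-Reasoning
  a′ = ℚᵘ.mkℚᵘ (ℤ.+ a) 0
  b′ = ℚᵘ.mkℚᵘ (ℤ.+ b) 0

toℚ-* : ∀ a b → toℚ (a ℕ.* b) ≡ toℚ a ℚ.* toℚ b
toℚ-* a b = sym (ℚₚ.toℚᵘ-injective (begin
  ℚ.toℚᵘ (toℚ a ℚ.* toℚ b)                  ≈⟨ ℚₚ.toℚᵘ-homo-* (toℚ a) (toℚ b) ⟩
  ℚ.toℚᵘ (toℚ a) ℚᵘ.* ℚ.toℚᵘ (toℚ b)         ≈⟨ ℚᵘₚ.*-cong (ℚₚ.toℚᵘ-fromℚᵘ a′) (ℚₚ.toℚᵘ-fromℚᵘ b′) ⟩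
  a′ ℚᵘ.* b′                                ≈⟨ ℚᵘ.*≡* (cong (ℤ._* ℤ.1ℤ) (sym (ℤₚ.pos-* a b))) ⟩
  ℚᵘ.mkℚᵘ (ℤ.+ (a ℕ.* b)) 0                 ≈⟨ ℚₚ.toℚᵘ-fromℚᵘ _ ⟨
  ℚ.toℚᵘ (toℚ (a ℕ.* b))                    ∎))
  where
  open ℚᵘₚ.≃-Reasoning
  a′ = ℚᵘ.mkℚᵘ (ℤ.+ a) 0
  b′ = ℚᵘ.mkℚᵘ (ℤ.+ b) 0

toℚ-suc : ∀ n → toℚ (suc n) ≡ 1ℚ ℚ.+ toℚ n
toℚ-suc = toℚ-+ 1

toℚ-suc≢0 : ∀ n → toℚ (suc n) ≢ 0ℚ
toℚ-suc≢0 n eq with ℚₚ.fromℚᵘ-injective {ℚᵘ.mkℚᵘ (ℤ.+ suc n) 0} {ℚᵘ.mkℚᵘ (ℤ.+ 0) 0} eq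
... | ℚᵘ.*≡* ()

-- Rational functions of d, defined at every d ≥ 1.

module RationalFunctions where
  open import Data.Rational using (_+_; _*_; _-_; -_)
  open ℚ-Solver using (solve; _:=_; _:+_; _:*_; :-_; con)

  *-≢0 : ∀ {p q} → p ≢ 0ℚ → q ≢ 0ℚ → p * q ≢ 0ℚ
  *-≢0 {p} {q} p≢0 q≢0 pq≡0 = q≢0 (begin
    q                 ≡⟨ ℚₚ.*-identityˡ q ⟨
    1ℚ * q            ≡⟨ cong (_* q) (ℚₚ.*-inverseˡ p) ⟨
    1/ p * p * q      ≡⟨ ℚₚ.*-assoc (1/ p) p q ⟩
    1/ p * (p * q)    ≡⟨ cong (1/ p *_) pq≡0 ⟩
    1/ p * 0ℚ         ≡⟨ ℚₚ.*-zeroʳ (1/ p) ⟩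
    0ℚ                ∎)
    where
    open ≡-Reasoning
    instance _ = ≢-nonZero p≢0

  addPoly : List ℚ → List ℚ → List ℚ
  addPoly []      q       = q
  addPoly (a ∷ p) []      = a ∷ p
  addPoly (a ∷ p) (b ∷ q) = a + b ∷ addPoly p q

  mulPoly : List ℚ → List ℚ → List ℚ
  mulPoly []      q = []
  mulPoly (a ∷ p) q = addPoly (map (a *_) q) (0ℚ ∷ mulPoly p q)

  evalPoly-add : ∀ p q x → evalPoly (addPoly p q) x ≡ evalPoly p x + evalPoly q x
  evalPoly-add []      q       x = sym (ℚₚ.+-identityˡ _)
  evalPoly-add (a ∷ p) []      x = sym (ℚₚ.+-identityʳ _)
  evalPoly-add (a ∷ p) (b ∷ q) x rewrite evalPoly-add p q x =
    solve 5 (λ a b x u v → (a :+ b) :+ x :* (u :+ v) := (a :+ x :* u) :+ (b :+ x :* v)) refl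
      a b x (evalPoly p x) (evalPoly q x)

  evalPoly-scale : ∀ c p x → evalPoly (map (c *_) p) x ≡ c * evalPoly p x
  evalPoly-scale c []      x = sym (ℚₚ.*-zeroʳ c)
  evalPoly-scale c (a ∷ p) x rewrite evalPoly-scale c p x =
    solve 4 (λ c a x u → c :* a :+ x :* (c :* u) := c :* (a :+ x :* u)) refl c a x (evalPoly p x)

  evalPoly-mul : ∀ p q x → evalPoly (mulPoly p q) x ≡ evalPoly p x * evalPoly q x
  evalPoly-mul []      q x = sym (ℚₚ.*-zeroˡ (evalPoly q x))
  evalPoly-mul (a ∷ p) q x
    rewrite evalPoly-add (map (a *_) q) (0ℚ ∷ mulPoly p q) x
          | evalPoly-scale a q x | evalPoly-mul p q x =
    solve 4 (λ a x u v → a :* v :+ (con 0ℚ :+ x :* (u :* v)) := (a :+ x :* u) :* v) refl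
      a x (evalPoly p x) (evalPoly q x)

  -- Functions of d are indexed by e with d = suc e, so that d ≥ 1 needs no hypothesis.
  record Rational (c : ℕ → ℚ) : Set where
    constructor rational
    field
      fraction : RatFun
      defined  : ∀ e → DefinedAt (toℚ (suc e)) fraction
      value    : ∀ e → c e * evalPoly (den fraction) (toℚ (suc e)) ≡ evalPoly (num fraction) (toℚ (suc e))

  open Rational public

  -- The field `value` is cross-multiplied, so closure under sums and products is a ring identity;
  -- division enters only here.
  value-evalRF : ∀ {c} (r : Rational c) e → c e ≡ evalRF (fraction r) (toℚ (suc e)) (defined r e)
  value-evalRF {c} r e = begin
    c e               ≡⟨ ℚₚ.*-identityʳ (c e) ⟨
    c e * 1ℚ          ≡⟨ cong (c e *_) (ℚₚ.*-inverseʳ q) ⟨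
    c e * (q * 1/ q)  ≡⟨ ℚₚ.*-assoc (c e) q (1/ q) ⟨
    c e * q * 1/ q    ≡⟨ cong (_* 1/ q) (value r e) ⟩
    _                 ∎
    where
    open ≡-Reasoning
    q = evalPoly (den (fraction r)) (toℚ (suc e))
    instance _ = ≢-nonZero (defined r e)

  Rational-cong : ∀ {c c′} → (∀ e → c′ e ≡ c e) → Rational c → Rational c′
  Rational-cong c′≡c (rational f def val) =
    rational f def λ e → trans (cong (_* evalPoly (den f) (toℚ (suc e))) (c′≡c e)) (val e)

  Rational-poly : ∀ p → Rational (λ e → evalPoly p (toℚ (suc e)))
  Rational-poly p = rational (p ⁄ (1ℚ ∷ []))
    (λ e eq → 1≢0 (trans (sym (den≡1 e)) eq))
    (λ e → trans (cong (evalPoly p (toℚ (suc e)) *_) (den≡1 e)) (ℚₚ.*-identityʳ _))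
    where
    1≢0 : 1ℚ ≢ 0ℚ
    1≢0 ()
    den≡1 : ∀ e → 1ℚ + toℚ (suc e) * 0ℚ ≡ 1ℚ
    den≡1 e = trans (cong (1ℚ +_) (ℚₚ.*-zeroʳ (toℚ (suc e)))) (ℚₚ.+-identityʳ 1ℚ)

  Rational-const : ∀ q → Rational (λ _ → q)
  Rational-const q = Rational-cong
    (λ e → sym (trans (cong (q +_) (ℚₚ.*-zeroʳ (toℚ (suc e)))) (ℚₚ.+-identityʳ q)))
    (Rational-poly (q ∷ []))

  Rational-d : Rational (λ e → toℚ (suc e))
  Rational-d = Rational-cong
    (λ e → solve 1 (λ x → x := con 0ℚ :+ x :* (con 1ℚ :+ x :* con 0ℚ)) refl (toℚ (suc e)))
    (Rational-poly (0ℚ ∷ 1ℚ ∷ []))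

  +-fraction : ∀ p q p′ q′ x c c′ → c * evalPoly q x ≡ evalPoly p x → c′ * evalPoly q′ x ≡ evalPoly p′ x →
               (c + c′) * evalPoly (mulPoly q q′) x ≡ evalPoly (addPoly (mulPoly p q′) (mulPoly p′ q)) x
  +-fraction p q p′ q′ x c c′ eq eq′
    rewrite evalPoly-add (mulPoly p q′) (mulPoly p′ q) x
          | evalPoly-mul q q′ x | evalPoly-mul p q′ x | evalPoly-mul p′ q x | sym eq | sym eq′ =
    solve 4 (λ c c′ x y → (c :+ c′) :* (x :* y) := c :* x :* y :+ c′ :* y :* x) refl
      c c′ (evalPoly q x) (evalPoly q′ x)

  *-fraction : ∀ p q p′ q′ x c c′ → c * evalPoly q x ≡ evalPoly p x → c′ * evalPoly q′ x ≡ evalPoly p′ x →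
               (c * c′) * evalPoly (mulPoly q q′) x ≡ evalPoly (mulPoly p p′) x
  *-fraction p q p′ q′ x c c′ eq eq′
    rewrite evalPoly-mul q q′ x | evalPoly-mul p p′ x | sym eq | sym eq′ =
    solve 4 (λ c c′ x y → (c :* c′) :* (x :* y) := c :* x :* (c′ :* y)) refl
      c c′ (evalPoly q x) (evalPoly q′ x)

  mulPoly-≢0 : ∀ p q x → evalPoly p x ≢ 0ℚ → evalPoly q x ≢ 0ℚ → evalPoly (mulPoly p q) x ≢ 0ℚ
  mulPoly-≢0 p q x p≢0 q≢0 eq = *-≢0 p≢0 q≢0 (trans (sym (evalPoly-mul p q x)) eq)

  Rational-+ : ∀ {c c′} → Rational c → Rational c′ → Rational (λ e → c e + c′ e)
  Rational-+ {c} {c′} (rational (p ⁄ q) def val) (rational (p′ ⁄ q′) def′ val′) = rational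
    (addPoly (mulPoly p q′) (mulPoly p′ q) ⁄ mulPoly q q′)
    (λ e → mulPoly-≢0 q q′ (toℚ (suc e)) (def e) (def′ e))
    (λ e → +-fraction p q p′ q′ (toℚ (suc e)) (c e) (c′ e) (val e) (val′ e))

  Rational-* : ∀ {c c′} → Rational c → Rational c′ → Rational (λ e → c e * c′ e)
  Rational-* {c} {c′} (rational (p ⁄ q) def val) (rational (p′ ⁄ q′) def′ val′) = rational
    (mulPoly p p′ ⁄ mulPoly q q′)
    (λ e → mulPoly-≢0 q q′ (toℚ (suc e)) (def e) (def′ e))
    (λ e → *-fraction p q p′ q′ (toℚ (suc e)) (c e) (c′ e) (val e) (val′ e))

  Rational-neg : ∀ {c} → Rational c → Rational (λ e → - c e)
  Rational-neg {c} r = Rational-cong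
    (λ e → solve 1 (λ x → :- x := con (- 1ℚ) :* x) refl (c e))
    (Rational-* (Rational-const (- 1ℚ)) r)

  Rational-minus : ∀ {c c′} → Rational c → Rational c′ → Rational (λ e → c e - c′ e)
  Rational-minus r s = Rational-+ r (Rational-neg s)

  -- Every denominator that has to be inverted is a positive natural number at each d, so writing it
  -- as `suc (m e)` makes it visibly nonzero.
  reciprocal : (ℕ → ℕ) → ℕ → ℚ
  reciprocal m e = (1/ toℚ (suc (m e))) {{≢-nonZero (toℚ-suc≢0 (m e))}}

  reciprocal-inverse : ∀ m e → reciprocal m e * toℚ (suc (m e)) ≡ 1ℚ
  reciprocal-inverse m e = ℚₚ.*-inverseˡ (toℚ (suc (m e)))
    where instance _ = ≢-nonZero (toℚ-suc≢0 (m e))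

  Rational-reciprocal : ∀ p m → (∀ e → evalPoly p (toℚ (suc e)) ≡ toℚ (suc (m e))) → Rational (reciprocal m)
  Rational-reciprocal p m eq = rational ((1ℚ ∷ []) ⁄ p)
    (λ e → subst (_≢ 0ℚ) (sym (eq e)) (toℚ-suc≢0 (m e)))
    (λ e → trans (cong (reciprocal m e *_) (eq e)) (trans (reciprocal-inverse m e)
      (solve 1 (λ x → con 1ℚ := con 1ℚ :+ x :* con 0ℚ) refl (toℚ (suc e)))))

  d⁻¹ : ℕ → ℚ
  d⁻¹ = reciprocal (λ e → e)

  Rational-d⁻¹ : Rational d⁻¹
  Rational-d⁻¹ = Rational-reciprocal (0ℚ ∷ 1ℚ ∷ []) (λ e → e)
    (λ e → solve 1 (λ x → con 0ℚ :+ x :* (con 1ℚ :+ x :* con 0ℚ) := x) refl (toℚ (suc e)))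

  -- The inverse of the discriminant 1 + 4d of x² − x − d.
  Δ⁻¹ : ℕ → ℚ
  Δ⁻¹ = reciprocal (λ e → 4 ℕ.* suc e)

  Δ-value : ∀ e → toℚ (suc (4 ℕ.* suc e)) ≡ 1ℚ + toℚ 4 * toℚ (suc e)
  Δ-value e = trans (toℚ-suc (4 ℕ.* suc e)) (cong (1ℚ +_) (toℚ-* 4 (suc e)))

  Rational-Δ⁻¹ : Rational Δ⁻¹
  Rational-Δ⁻¹ = Rational-reciprocal (1ℚ ∷ toℚ 4 ∷ []) (λ e → 4 ℕ.* suc e)
    (λ e → trans
      (solve 1 (λ x → con 1ℚ :+ x :* (con (toℚ 4) :+ x :* con 0ℚ) := con 1ℚ :+ con (toℚ 4) :* x) refl (toℚ (suc e)))
      (sym (Δ-value e)))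


-- Polynomials in the index times solutions of the recurrence of M_d, and inhomogeneous recurrences.

module QuasiPolynomials where
  open import Data.Rational using (_+_; _*_; _-_; -_)
  open ℚ-Solver using (solve; _:=_; _:+_; _:*_; _:-_; :-_; con)
  open RationalFunctions

  abstract
    -- Opaque, so that binomials stay atoms in ring identities; `binom≡` is the only access to the
    -- definition.
    binom : ℕ → ℕ → ℚ
    binom j i = toℚ (j C i)

    binom≡ : ∀ j i → binom j i ≡ toℚ (j C i)
    binom≡ j i = refl

  -- C(j, i − 1), with C(j, −1) = 0.
  binom⁻ : ℕ → ℕ → ℚ
  binom⁻ j zero    = 0ℚ
  binom⁻ j (suc i) = binom j i

  binom-0 : ∀ j → binom j 0 ≡ 1ℚ
  binom-0 j = binom≡ j 0

  binom-0-suc : ∀ i → binom 0 (suc i) ≡ 0ℚ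
  binom-0-suc i = trans (binom≡ 0 (suc i)) (cong toℚ (k>n⇒nCk≡0 {0} {suc i} (ℕ.s≤s ℕ.z≤n)))

  binom-suc : ∀ j i → binom (suc j) i ≡ binom j i + binom⁻ j i
  binom-suc j zero    = trans (binom-0 (suc j)) (sym (trans (cong (_+ 0ℚ) (binom-0 j)) refl))
  binom-suc j (suc i) = begin
    binom (suc j) (suc i)                ≡⟨ binom≡ (suc j) (suc i) ⟩
    toℚ (suc j C suc i)                  ≡⟨ cong toℚ (nCk+nC[k+1]≡[n+1]C[k+1] j i) ⟨
    toℚ (j C i ℕ.+ j C suc i)            ≡⟨ toℚ-+ (j C i) (j C suc i) ⟩
    toℚ (j C i) + toℚ (j C suc i)        ≡⟨ cong₂ _+_ (binom≡ j i) (binom≡ j (suc i)) ⟨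
    binom j i + binom j (suc i)          ≡⟨ ℚₚ.+-comm (binom j i) (binom j (suc i)) ⟩
    binom j (suc i) + binom j i          ∎
    where open ≡-Reasoning

  -- μ e j is M_d(j − 1) for d = suc e.
  abstract
    μ : ℕ → ℕ → ℚ
    μ e zero    = 0ℚ
    μ e (suc j) = toℚ (M (suc e) j)

    μ-0 : ∀ e → μ e 0 ≡ 0ℚ
    μ-0 e = refl

    μ-suc : ∀ e j → μ e (suc j) ≡ toℚ (M (suc e) j)
    μ-suc e j = refl

  μ-step : ∀ e j → μ e (suc (suc j)) ≡ μ e (suc j) + toℚ (suc e) * μ e j
  μ-step e zero    = trans (μ-suc e 1) (sym (trans
    (cong₂ (λ x y → x + toℚ (suc e) * y) (μ-suc e 0) (μ-0 e))
    (trans (cong (1ℚ +_) (ℚₚ.*-zeroʳ (toℚ (suc e)))) (ℚₚ.+-identityʳ 1ℚ))))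
  μ-step e (suc j) = begin
    μ e (suc (suc (suc j)))
      ≡⟨ μ-suc e (suc (suc j)) ⟩
    toℚ (M (suc e) (suc j) ℕ.+ suc e ℕ.* M (suc e) j)
      ≡⟨ trans (toℚ-+ (M (suc e) (suc j)) (suc e ℕ.* M (suc e) j)) (cong (toℚ (M (suc e) (suc j)) +_) (toℚ-* (suc e) (M (suc e) j))) ⟩
    toℚ (M (suc e) (suc j)) + toℚ (suc e) * toℚ (M (suc e) j)
      ≡⟨ cong₂ (λ x y → x + toℚ (suc e) * y) (μ-suc e (suc j)) (μ-suc e j) ⟨
    μ e (suc (suc j)) + toℚ (suc e) * μ e (suc j) ∎
    where open ≡-Reasoning

  Rational-μ : ∀ j → Rational (λ e → μ e j)
  Rational-μ zero          = Rational-cong μ-0 (Rational-const 0ℚ)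
  Rational-μ (suc zero)    = Rational-cong (λ e → μ-suc e 0) (Rational-const 1ℚ)
  Rational-μ (suc (suc j)) = Rational-cong (λ e → μ-step e j)
    (Rational-+ (Rational-μ (suc j)) (Rational-* Rational-d (Rational-μ j)))

  combination : (p q : ℕ → ℚ) → ℕ → ℕ → ℚ
  combination p q e j = p e * μ e j + q e * μ e (suc j)

  -- Quasi m f: f e j = Σ_{i<m} C(j,i) (p_i(d) μ e j + q_i(d) μ e (j+1)). In the Newton basis C(j,i) the
  -- difference operator lowers the index by one, which makes the recurrence of μ easy to invert.
  data Quasi : ℕ → (ℕ → ℕ → ℚ) → Set where
    none : ∀ {f} → (∀ e j → f e j ≡ 0ℚ) → Quasi zero f
    term : ∀ {m f g p q} → Quasi m g → Rational p → Rational q →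
           (∀ e j → f e j ≡ g e j + binom j m * combination p q e j) → Quasi (suc m) f

  Quasi-cong : ∀ {m f g} → (∀ e j → g e j ≡ f e j) → Quasi m f → Quasi m g
  Quasi-cong g≡f (none f≡0)         = none λ e j → trans (g≡f e j) (f≡0 e j)
  Quasi-cong g≡f (term h rp rq f≡)  = term h rp rq λ e j → trans (g≡f e j) (f≡ e j)

  Quasi-suc : ∀ {m f} → Quasi m f → Quasi (suc m) f
  Quasi-suc {m} {f} h = term h (Rational-const 0ℚ) (Rational-const 0ℚ) λ e j →
    solve 4 (λ x b u v → x := x :+ b :* (con 0ℚ :* u :+ con 0ℚ :* v)) refl (f e j) (binom j m) (μ e j) (μ e (suc j))

  Quasi-0 : ∀ m → Quasi m (λ _ _ → 0ℚ)
  Quasi-0 zero    = none λ _ _ → refl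
  Quasi-0 (suc m) = Quasi-suc (Quasi-0 m)

  Quasi-+ : ∀ {m f g} → Quasi m f → Quasi m g → Quasi m (λ e j → f e j + g e j)
  Quasi-+ (none f≡0) (none g≡0) = none λ e j → cong₂ _+_ (f≡0 e j) (g≡0 e j)
  Quasi-+ (term {m} {g = f₀} {p} {q} hf rp rq f≡) (term {g = g₀} {p′} {q′} hg rp′ rq′ g≡) =
    term (Quasi-+ hf hg) (Rational-+ rp rp′) (Rational-+ rq rq′) λ e j →
      trans (cong₂ _+_ (f≡ e j) (g≡ e j))
        (solve 9 (λ x y b p q p′ q′ u v →
            (x :+ b :* (p :* u :+ q :* v)) :+ (y :+ b :* (p′ :* u :+ q′ :* v))
            := (x :+ y) :+ b :* ((p :+ p′) :* u :+ (q :+ q′) :* v)) refl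
          (f₀ e j) (g₀ e j) (binom j m) (p e) (q e) (p′ e) (q′ e) (μ e j) (μ e (suc j)))

  Quasi-term : ∀ m {p q} → Rational p → Rational q → Quasi (suc m) (λ e j → binom j m * combination p q e j)
  Quasi-term m rp rq = term (Quasi-0 m) rp rq λ e j → sym (ℚₚ.+-identityˡ _)

  Quasi-term⁻ : ∀ m {p q} → Rational p → Rational q → Quasi m (λ e j → binom⁻ j m * combination p q e j)
  Quasi-term⁻ zero {p} {q} rp rq = none λ e j → ℚₚ.*-zeroˡ (combination p q e j)
  Quasi-term⁻ (suc m) rp rq = Quasi-term m rp rq

  Quasi-combination : ∀ m {p q} → Rational p → Rational q → Quasi (suc m) (combination p q)
  Quasi-combination zero {p} {q} rp rq = Quasi-cong
    (λ e j → sym (trans (cong (_* combination p q e j) (binom-0 j)) (ℚₚ.*-identityˡ _))) (Quasi-term 0 rp rq)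
  Quasi-combination (suc m) rp rq = Quasi-suc (Quasi-combination m rp rq)

  -- The companion matrix of x² - x - d: the coordinates, with respect to `μ e j` and `μ e (suc j)`,
  -- of a shifted combination.
  shiftˡ shiftʳ : (p q : ℕ → ℚ) → ℕ → ℚ
  shiftˡ p q e = toℚ (suc e) * q e
  shiftʳ p q e = p e + q e

  Rational-shiftˡ : ∀ {p q} → Rational p → Rational q → Rational (shiftˡ p q)
  Rational-shiftˡ rp rq = Rational-* Rational-d rq

  combination-suc : ∀ p q e j → combination p q e (suc j) ≡ combination (shiftˡ p q) (shiftʳ p q) e j
  combination-suc p q e j = trans (cong (λ x → p e * μ e (suc j) + q e * x) (μ-step e j))
    (solve 5 (λ p q d u v → p :* v :+ q :* (v :+ d :* u) := d :* q :* u :+ (p :+ q) :* v) refl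
      (p e) (q e) (toℚ (suc e)) (μ e j) (μ e (suc j)))

  combination-step : ∀ p q e j → combination p q e (suc (suc j)) ≡
                     combination p q e (suc j) + toℚ (suc e) * combination p q e j
  combination-step p q e j = trans
    (cong₂ (λ x y → p e * x + q e * y) (μ-step e j) (trans (μ-step e (suc j)) (cong (_+ toℚ (suc e) * μ e (suc j)) (μ-step e j))))
    (trans (solve 5 (λ p q d u v → p :* (v :+ d :* u) :+ q :* (v :+ d :* u :+ d :* v)
                                   := (p :* v :+ q :* (v :+ d :* u)) :+ d :* (p :* u :+ q :* v)) refl
              (p e) (q e) (toℚ (suc e)) (μ e j) (μ e (suc j)))
           (cong (λ x → p e * μ e (suc j) + q e * x + toℚ (suc e) * combination p q e j) (sym (μ-step e j))))

  -- By Pascal's rule the shift of C(j,m) only adds C(j,m-1), which joins the lower terms, so the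
  -- index m does not grow.
  Quasi-shift : ∀ {m f} → Quasi m f → Quasi m (λ e j → f e (suc j))
  Quasi-shift (none f≡0) = none λ e j → f≡0 e (suc j)
  Quasi-shift (term {m} {f} {g} {p} {q} h rp rq f≡) =
    term (Quasi-+ (Quasi-shift h) (Quasi-term⁻ m rp′ rq′)) rp′ rq′ λ e j →
      trans (f≡ e (suc j))
        (trans (cong₂ (λ x y → g e (suc j) + x * y) (binom-suc j m) (combination-suc p q e j))
          (solve 4 (λ x b b⁻ w → x :+ (b :+ b⁻) :* w := (x :+ b⁻ :* w) :+ b :* w) refl
            (g e (suc j)) (binom j m) (binom⁻ j m) (combination (shiftˡ p q) (shiftʳ p q) e j)))
    where
    rp′ = Rational-shiftˡ rp rq
    rq′ = Rational-+ rp rq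

  Quasi-value : ∀ {m f} → Quasi m f → ∀ j → Rational (λ e → f e j)
  Quasi-value (none f≡0) j = Rational-cong (λ e → f≡0 e j) (Rational-const 0ℚ)
  Quasi-value (term {m} h rp rq f≡) j = Rational-cong (λ e → f≡ e j)
    (Rational-+ (Quasi-value h j) (Rational-* (Rational-const (binom j m))
      (Rational-+ (Rational-* rp (Rational-μ j)) (Rational-* rq (Rational-μ (suc j))))))

  Recurrence : (f g : ℕ → ℕ → ℚ) → Set
  Recurrence f g = ∀ e j → f e (suc (suc j)) ≡ f e (suc j) + toℚ (suc e) * f e j + g e j

  -- With S the shift of μ, so S² = S + d, the recurrence operator sends C(j,m+1) w to
  -- C(j,m) (S + 2d) w + C(j,m−1) S² w, and (S + 2d)⁻¹ = ((1 + 2d) − S) / (d (1 + 4d)).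
  module LeadingTerm (p q : ℕ → ℚ) where
    scale : ℕ → ℚ
    scale e = d⁻¹ e * Δ⁻¹ e

    leadˡ leadʳ : ℕ → ℚ
    leadˡ e = scale e * ((1ℚ + (toℚ (suc e) + toℚ (suc e))) * p e - toℚ (suc e) * q e)
    leadʳ e = scale e * ((toℚ (suc e) + toℚ (suc e)) * q e - p e)

    scale-inverse : ∀ e → scale e * (toℚ (suc e) * (1ℚ + toℚ 4 * toℚ (suc e))) ≡ 1ℚ
    scale-inverse e = begin
      scale e * (toℚ (suc e) * (1ℚ + toℚ 4 * toℚ (suc e)))
        ≡⟨ cong (λ x → scale e * (toℚ (suc e) * x)) (Δ-value e) ⟨
      d⁻¹ e * Δ⁻¹ e * (toℚ (suc e) * toℚ (suc (4 ℕ.* suc e)))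
        ≡⟨ solve 4 (λ a b c d → a :* b :* (c :* d) := (a :* c) :* (b :* d)) refl
             (d⁻¹ e) (Δ⁻¹ e) (toℚ (suc e)) (toℚ (suc (4 ℕ.* suc e))) ⟩
      d⁻¹ e * toℚ (suc e) * (Δ⁻¹ e * toℚ (suc (4 ℕ.* suc e)))
        ≡⟨ cong₂ _*_ (reciprocal-inverse (λ e → e) e) (reciprocal-inverse (λ e → 4 ℕ.* suc e) e) ⟩
      1ℚ ∎
      where open ≡-Reasoning

    lead-value : ∀ e j → combination leadˡ leadʳ e (suc j) + (toℚ (suc e) + toℚ (suc e)) * combination leadˡ leadʳ e j
                         ≡ combination p q e j
    lead-value e j = trans
      (cong (_+ (toℚ (suc e) + toℚ (suc e)) * combination leadˡ leadʳ e j) (combination-suc leadˡ leadʳ e j))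
      (trans (identity (scale e) (toℚ (suc e)) (p e) (q e) (μ e j) (μ e (suc j)))
        (trans (cong (_* combination p q e j) (scale-inverse e)) (ℚₚ.*-identityˡ _)))
      where
      identity : ∀ s d p q u v →
        let P = s * ((1ℚ + (d + d)) * p - d * q)
            Q = s * ((d + d) * q - p)
        in d * Q * u + (P + Q) * v + (d + d) * (P * u + Q * v) ≡ s * (d * (1ℚ + toℚ 4 * d)) * (p * u + q * v)
      identity = solve 6 (λ s d p q u v →
        let P = s :* ((con 1ℚ :+ (d :+ d)) :* p :- d :* q)
            Q = s :* ((d :+ d) :* q :- p)
        in d :* Q :* u :+ (P :+ Q) :* v :+ (d :+ d) :* (P :* u :+ Q :* v)
           := s :* (d :* (con 1ℚ :+ con (toℚ 4) :* d)) :* (p :* u :+ q :* v)) refl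

    Rational-scale : Rational scale
    Rational-scale = Rational-* Rational-d⁻¹ Rational-Δ⁻¹

    Rational-2d : Rational (λ e → toℚ (suc e) + toℚ (suc e))
    Rational-2d = Rational-+ Rational-d Rational-d

    Rational-leadˡ : Rational p → Rational q → Rational leadˡ
    Rational-leadˡ rp rq = Rational-* Rational-scale
      (Rational-minus (Rational-* (Rational-+ (Rational-const 1ℚ) Rational-2d) rp) (Rational-* Rational-d rq))

    Rational-leadʳ : Rational p → Rational q → Rational leadʳ
    Rational-leadʳ rp rq = Rational-* Rational-scale (Rational-minus (Rational-* Rational-2d rq) rp)

  -- Induction on the leading Newton term. Choosing w with (S + 2d) w equal to the leading
  -- combination, C(j,m+1) w produces that term and the excess C(j,m-1) S² w. The excess has a lower
  -- index, so its negative is added to the remaining right-hand side before recursing.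
  Quasi-particular : ∀ {m g} → Quasi m g → ∃ λ u → Quasi (suc m) u × Recurrence u g
  Quasi-particular (none {g} g≡0) = (λ _ _ → 0ℚ) , Quasi-0 1 , λ e j → trans
    (solve 1 (λ d → con 0ℚ := con 0ℚ :+ d :* con 0ℚ :+ con 0ℚ) refl (toℚ (suc e)))
    (cong (0ℚ + toℚ (suc e) * 0ℚ +_) (sym (g≡0 e j)))
  Quasi-particular (term {m} {g} {g₀} {p} {q} h rp rq g≡) =
    (λ e j → u₁ e j + binom j (suc m) * w e j) , term quasi₁ rP rQ (λ _ _ → refl) , rec
    where
    open LeadingTerm p q
    rP = Rational-leadˡ rp rq
    rQ = Rational-leadʳ rp rq
    rP₁ = Rational-shiftˡ rP rQ
    rQ₁ = Rational-+ rP rQ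
    w = combination leadˡ leadʳ

    correction : Quasi m (λ e j → binom⁻ j m * (- w e (suc (suc j))))
    correction = Quasi-cong
      (λ e j → cong (binom⁻ j m *_) (trans
        (cong -_ (trans (combination-suc leadˡ leadʳ e (suc j)) (combination-suc (shiftˡ leadˡ leadʳ) (shiftʳ leadˡ leadʳ) e j)))
        (solve 4 (λ P Q u v → :- (P :* u :+ Q :* v) := (:- P) :* u :+ (:- Q) :* v) refl
          (shiftˡ (shiftˡ leadˡ leadʳ) (shiftʳ leadˡ leadʳ) e) (shiftʳ (shiftˡ leadˡ leadʳ) (shiftʳ leadˡ leadʳ) e) (μ e j) (μ e (suc j)))))
      (Quasi-term⁻ m (Rational-neg (Rational-shiftˡ rP₁ rQ₁)) (Rational-neg (Rational-+ rP₁ rQ₁)))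

    particular = Quasi-particular (Quasi-+ h correction)
    u₁     = proj₁ particular
    quasi₁ = proj₁ (proj₂ particular)

    identity : ∀ a₁ a₀ g₀ d b₁ b₀ b⁻ w₁ w₀ →
      (a₁ + d * a₀ + (g₀ + b⁻ * (- (w₁ + d * w₀)))) + ((b₁ + b₀) + (b₀ + b⁻)) * (w₁ + d * w₀) ≡
      (a₁ + (b₁ + b₀) * w₁) + d * (a₀ + b₁ * w₀) + (g₀ + b₀ * (w₁ + (d + d) * w₀))
    identity = solve 9 (λ a₁ a₀ g₀ d b₁ b₀ b⁻ w₁ w₀ →
      (a₁ :+ d :* a₀ :+ (g₀ :+ b⁻ :* (:- (w₁ :+ d :* w₀)))) :+ ((b₁ :+ b₀) :+ (b₀ :+ b⁻)) :* (w₁ :+ d :* w₀) :=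
      (a₁ :+ (b₁ :+ b₀) :* w₁) :+ d :* (a₀ :+ b₁ :* w₀) :+ (g₀ :+ b₀ :* (w₁ :+ (d :+ d) :* w₀))) refl

    rec : Recurrence (λ e j → u₁ e j + binom j (suc m) * w e j) g
    rec e j = begin
      u₁ e (suc (suc j)) + binom (suc (suc j)) (suc m) * w e (suc (suc j))
        ≡⟨ cong₂ _+_ (proj₂ (proj₂ particular) e j) (cong (_* w e (suc (suc j)))
             (trans (binom-suc (suc j) (suc m)) (cong₂ _+_ (binom-suc j (suc m)) (binom-suc j m)))) ⟩
      (u₁ e (suc j) + d * u₁ e j + (g₀ e j + b⁻ * (- w e (suc (suc j))))) + ((b₁ + b₀) + (b₀ + b⁻)) * w e (suc (suc j))
        ≡⟨ cong (λ x → (u₁ e (suc j) + d * u₁ e j + (g₀ e j + b⁻ * (- x))) + ((b₁ + b₀) + (b₀ + b⁻)) * x)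
             (combination-step leadˡ leadʳ e j) ⟩
      _
        ≡⟨ identity (u₁ e (suc j)) (u₁ e j) (g₀ e j) d b₁ b₀ b⁻ (w e (suc j)) (w e j) ⟩
      (u₁ e (suc j) + (b₁ + b₀) * w e (suc j)) + d * (u₁ e j + b₁ * w e j) + (g₀ e j + b₀ * (w e (suc j) + (d + d) * w e j))
        ≡⟨ cong₂ (λ x y → (u₁ e (suc j) + x * w e (suc j)) + d * (u₁ e j + b₁ * w e j) + y)
             (sym (binom-suc j (suc m))) (trans (cong (λ x → g₀ e j + b₀ * x) (lead-value e j)) (sym (g≡ e j))) ⟩
      (u₁ e (suc j) + binom (suc j) (suc m) * w e (suc j)) + d * (u₁ e j + b₁ * w e j) + g e j ∎
      where
      open ≡-Reasoning
      d = toℚ (suc e)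
      b₁ = binom j (suc m)
      b₀ = binom j m
      b⁻ = binom⁻ j m

  -- Minus a particular solution, f solves the homogeneous recurrence and is thus a combination of
  -- `μ` and its shift. Its two constants come from the values at 0 and 1, which is why these must
  -- be rational in d.
  Quasi-recurrence : ∀ {m f g} → Rational (λ e → f e 0) → Rational (λ e → f e 1) →
                     Quasi m g → Recurrence f g → Quasi (suc m) f
  Quasi-recurrence {m} {f} {g} r₀ r₁ h rec =
    Quasi-cong (λ e j → proj₁ (agree e j)) (Quasi-+ quasi (Quasi-combination m rα rβ))
    where
    particular = Quasi-particular h
    u     = proj₁ particular
    quasi = proj₁ (proj₂ particular)
    α β : ℕ → ℚ
    -- Since μ takes the values 0, 1, 1 at 0, 1, 2, a combination is β at index 0 and α + β at index
    -- 1.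
    β e = f e 0 - u e 0
    α e = f e 1 - u e 1 - β e
    rβ = Rational-minus r₀ (Quasi-value quasi 0)
    rα = Rational-minus (Rational-minus r₁ (Quasi-value quasi 1)) rβ
    μ-2 : ∀ e → μ e 2 ≡ 1ℚ
    μ-2 e = μ-suc e 1
    agree : ∀ e j → f e j ≡ u e j + combination α β e j × f e (suc j) ≡ u e (suc j) + combination α β e (suc j)
    agree e zero = trans
        (solve 4 (λ x a b v → x := a :+ (b :* con 0ℚ :+ (x :- a) :* con 1ℚ)) refl (f e 0) (u e 0) (α e) 0ℚ)
        (cong₂ (λ x y → u e 0 + (α e * x + β e * y)) (sym (μ-0 e)) (sym (μ-suc e 0)))
      , trans
        (solve 3 (λ x a b → x := a :+ ((x :- a :- b) :* con 1ℚ :+ b :* con 1ℚ)) refl (f e 1) (u e 1) (β e))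
        (cong₂ (λ x y → u e 1 + (α e * x + β e * y)) (sym (μ-suc e 0)) (sym (μ-2 e)))
    agree e (suc j) with agree e j
    ... | eq₀ , eq₁ = eq₁ , (begin
      f e (suc (suc j))
        ≡⟨ rec e j ⟩
      f e (suc j) + d * f e j + g e j
        ≡⟨ cong₂ (λ x y → x + d * y + g e j) eq₁ eq₀ ⟩
      (u e (suc j) + w₁) + d * (u e j + w₀) + g e j
        ≡⟨ solve 6 (λ a₁ a₀ w₁ w₀ d g → (a₁ :+ w₁) :+ d :* (a₀ :+ w₀) :+ g := (a₁ :+ d :* a₀ :+ g) :+ (w₁ :+ d :* w₀)) refl
             (u e (suc j)) (u e j) w₁ w₀ d (g e j) ⟩
      (u e (suc j) + d * u e j + g e j) + (w₁ + d * w₀)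
        ≡⟨ cong₂ _+_ (sym (proj₂ (proj₂ particular) e j)) (sym (combination-step α β e j)) ⟩
      u e (suc (suc j)) + combination α β e (suc (suc j)) ∎)
      where
      open ≡-Reasoning
      d = toℚ (suc e)
      w₁ = combination α β e (suc j)
      w₀ = combination α β e j

-- The Newton basis: multiplication by the variable, and summation.

module Binomials where
  open import Data.Rational using (_+_; _*_; _-_; -_)
  open ℚ-Solver using (solve; _:=_; _:+_; _:*_; _:-_; con)
  open RationalFunctions
  open QuasiPolynomials

  -- Proved together with the form for C(j,i-1), since expanding C(j+2,i+1) by Pascal's rule calls
  -- for both.
  binom-absorb : ∀ j i → (1ℚ + toℚ j) * binom j i ≡ (1ℚ + toℚ i) * binom (suc j) (suc i)
  binom-absorb⁻ : ∀ j i → (1ℚ + toℚ j) * binom⁻ j i ≡ toℚ i * binom (suc j) i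
  binom-absorb zero zero = trans (cong ((1ℚ + 0ℚ) *_) (binom-0 0)) (cong ((1ℚ + 0ℚ) *_)
    (sym (trans (binom-suc 0 1) (cong₂ _+_ (binom-0-suc 0) (binom-0 0)))))
  binom-absorb zero (suc i) = trans (cong ((1ℚ + 0ℚ) *_) (binom-0-suc i)) (sym (trans
    (cong ((1ℚ + toℚ (suc i)) *_) (trans (binom-suc 0 (suc (suc i))) (cong₂ _+_ (binom-0-suc (suc i)) (binom-0-suc i))))
    (ℚₚ.*-zeroʳ (1ℚ + toℚ (suc i)))))
  binom-absorb (suc j) i = sym (begin
    (1ℚ + toℚ i) * binom (suc (suc j)) (suc i)
      ≡⟨ cong ((1ℚ + toℚ i) *_) (binom-suc (suc j) (suc i)) ⟩
    (1ℚ + toℚ i) * (binom (suc j) (suc i) + binom (suc j) i)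
      ≡⟨ solve 3 (λ i x y → (con 1ℚ :+ i) :* (x :+ y) := (con 1ℚ :+ i) :* x :+ i :* y :+ y) refl
           (toℚ i) (binom (suc j) (suc i)) (binom (suc j) i) ⟩
    (1ℚ + toℚ i) * binom (suc j) (suc i) + toℚ i * binom (suc j) i + binom (suc j) i
      ≡⟨ cong₂ (λ x y → x + y + binom (suc j) i) (binom-absorb j i) (binom-absorb⁻ j i) ⟨
    (1ℚ + toℚ j) * binom j i + (1ℚ + toℚ j) * binom⁻ j i + binom (suc j) i
      ≡⟨ cong (_+ binom (suc j) i) (ℚₚ.*-distribˡ-+ (1ℚ + toℚ j) (binom j i) (binom⁻ j i)) ⟨
    (1ℚ + toℚ j) * (binom j i + binom⁻ j i) + binom (suc j) i
      ≡⟨ cong (λ x → (1ℚ + toℚ j) * x + binom (suc j) i) (binom-suc j i) ⟨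
    (1ℚ + toℚ j) * binom (suc j) i + binom (suc j) i
      ≡⟨ solve 2 (λ x y → x :* y :+ y := (con 1ℚ :+ x) :* y) refl (1ℚ + toℚ j) (binom (suc j) i) ⟩
    (1ℚ + (1ℚ + toℚ j)) * binom (suc j) i
      ≡⟨ cong (λ x → (1ℚ + x) * binom (suc j) i) (toℚ-suc j) ⟨
    (1ℚ + toℚ (suc j)) * binom (suc j) i ∎)
    where open ≡-Reasoning
  binom-absorb⁻ j zero    = trans (ℚₚ.*-zeroʳ (1ℚ + toℚ j)) (sym (ℚₚ.*-zeroˡ (binom (suc j) 0)))
  binom-absorb⁻ j (suc i) = trans (binom-absorb j i) (cong (_* binom (suc j) (suc i)) (sym (toℚ-suc i)))

  *-binom : ∀ j i → toℚ j * binom j i ≡ toℚ (suc i) * binom j (suc i) + toℚ i * binom j i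
  *-binom j i = begin
    toℚ j * binom j i
      ≡⟨ solve 2 (λ j b → j :* b := (con 1ℚ :+ j) :* b :- b) refl (toℚ j) (binom j i) ⟩
    (1ℚ + toℚ j) * binom j i - binom j i
      ≡⟨ cong (_- binom j i) (trans (binom-absorb j i) (cong ((1ℚ + toℚ i) *_) (binom-suc j (suc i)))) ⟩
    (1ℚ + toℚ i) * (binom j (suc i) + binom j i) - binom j i
      ≡⟨ solve 3 (λ i x b → (con 1ℚ :+ i) :* (x :+ b) :- b := (con 1ℚ :+ i) :* x :+ i :* b) refl
           (toℚ i) (binom j (suc i)) (binom j i) ⟩
    (1ℚ + toℚ i) * binom j (suc i) + toℚ i * binom j i
      ≡⟨ cong (λ x → x * binom j (suc i) + toℚ i * binom j i) (toℚ-suc i) ⟨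
    toℚ (suc i) * binom j (suc i) + toℚ i * binom j i ∎
    where open ≡-Reasoning

  suc⁻¹ : ℕ → ℚ
  suc⁻¹ i = reciprocal (λ _ → i) 0

  binom-next : ∀ j i → binom j (suc i) ≡ suc⁻¹ i * ((toℚ j - toℚ i) * binom j i)
  binom-next j i = begin
    binom j (suc i)
      ≡⟨ ℚₚ.*-identityˡ (binom j (suc i)) ⟨
    1ℚ * binom j (suc i)
      ≡⟨ cong (_* binom j (suc i)) (reciprocal-inverse (λ _ → i) 0) ⟨
    suc⁻¹ i * toℚ (suc i) * binom j (suc i)
      ≡⟨ solve 4 (λ r s x y → r :* s :* x := r :* ((s :* x :+ y) :- y)) refl
           (suc⁻¹ i) (toℚ (suc i)) (binom j (suc i)) (toℚ i * binom j i) ⟩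
    suc⁻¹ i * (toℚ (suc i) * binom j (suc i) + toℚ i * binom j i - toℚ i * binom j i)
      ≡⟨ cong (λ x → suc⁻¹ i * (x - toℚ i * binom j i)) (*-binom j i) ⟨
    suc⁻¹ i * (toℚ j * binom j i - toℚ i * binom j i)
      ≡⟨ solve 4 (λ r j i b → r :* (j :* b :- i :* b) := r :* ((j :- i) :* b)) refl
           (suc⁻¹ i) (toℚ j) (toℚ i) (binom j i) ⟩
    suc⁻¹ i * ((toℚ j - toℚ i) * binom j i) ∎
    where open ≡-Reasoning

  binom-1 : ∀ j → binom j 1 ≡ toℚ j
  binom-1 j = trans (binom≡ j 1) (cong toℚ (nC1≡n j))

  binom-suc-2 : ∀ a → toℚ (suc a C 2) ≡ suc⁻¹ 1 * (toℚ a * (1ℚ + toℚ a))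
  binom-suc-2 a = begin
    toℚ (suc a C 2)
      ≡⟨ binom≡ (suc a) 2 ⟨
    binom (suc a) 2
      ≡⟨ binom-next (suc a) 1 ⟩
    suc⁻¹ 1 * ((toℚ (suc a) - 1ℚ) * binom (suc a) 1)
      ≡⟨ cong₂ (λ x y → suc⁻¹ 1 * ((x - 1ℚ) * y)) (toℚ-suc a) (trans (binom-1 (suc a)) (toℚ-suc a)) ⟩
    suc⁻¹ 1 * ((1ℚ + toℚ a - 1ℚ) * (1ℚ + toℚ a))
      ≡⟨ cong (suc⁻¹ 1 *_) (solve 1 (λ a → (con 1ℚ :+ a :- con 1ℚ) :* (con 1ℚ :+ a) := a :* (con 1ℚ :+ a)) refl (toℚ a)) ⟩
    suc⁻¹ 1 * (toℚ a * (1ℚ + toℚ a)) ∎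
    where open ≡-Reasoning

  Rational-binom : ∀ (h : ℕ → ℕ) → Rational (λ e → toℚ (h e)) → ∀ i → Rational (λ e → binom (h e) i)
  Rational-binom h r zero    = Rational-cong (λ e → binom-0 (h e)) (Rational-const 1ℚ)
  Rational-binom h r (suc i) = Rational-cong (λ e → binom-next (h e) i)
    (Rational-* (Rational-const (suc⁻¹ i)) (Rational-* (Rational-minus r (Rational-const (toℚ i))) (Rational-binom h r i)))

  sumTo : ℕ → (ℕ → ℚ) → ℚ
  sumTo zero    f = 0ℚ
  sumTo (suc n) f = f n + sumTo n f

  sumTo-cong : ∀ n {f g} → (∀ a → f a ≡ g a) → sumTo n f ≡ sumTo n g
  sumTo-cong zero    f≡g = refl
  sumTo-cong (suc n) f≡g = cong₂ _+_ (f≡g n) (sumTo-cong n f≡g)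

  sumTo-0 : ∀ n → sumTo n (λ _ → 0ℚ) ≡ 0ℚ
  sumTo-0 zero    = refl
  sumTo-0 (suc n) = trans (ℚₚ.+-identityˡ _) (sumTo-0 n)

  sumTo-+ : ∀ n f g → sumTo n (λ a → f a + g a) ≡ sumTo n f + sumTo n g
  sumTo-+ zero    f g = refl
  sumTo-+ (suc n) f g = trans (cong (f n + g n +_) (sumTo-+ n f g))
    (solve 4 (λ a b c d → a :+ b :+ (c :+ d) := (a :+ c) :+ (b :+ d)) refl (f n) (g n) (sumTo n f) (sumTo n g))

  sumTo-*ˡ : ∀ n c f → sumTo n (λ a → c * f a) ≡ c * sumTo n f
  sumTo-*ˡ zero    c f = sym (ℚₚ.*-zeroʳ c)
  sumTo-*ˡ (suc n) c f = trans (cong (c * f n +_) (sumTo-*ˡ n c f)) (sym (ℚₚ.*-distribˡ-+ c (f n) (sumTo n f)))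

  sumTo-binom : ∀ n i → sumTo n (λ a → binom a i) ≡ binom n (suc i)
  sumTo-binom zero    i = sym (binom-0-suc i)
  sumTo-binom (suc n) i = trans (cong (binom n i +_) (sumTo-binom n i))
    (trans (ℚₚ.+-comm (binom n i) (binom n (suc i))) (sym (binom-suc n (suc i))))

  -- Polynomials in an entry a with coefficients rational in d. In the binomial basis, summing over
  -- a < h(d) is the hockey-stick identity, so the result is again rational in d although the range
  -- depends on d.
  data Newton : ℕ → (ℕ → ℕ → ℚ) → Set where
    none : ∀ {c} → (∀ e a → c e a ≡ 0ℚ) → Newton zero c
    term : ∀ {m c g p} → Newton m g → Rational p → (∀ e a → c e a ≡ g e a + binom a m * p e) → Newton (suc m) c

  Newton-cong : ∀ {m c c′} → (∀ e a → c′ e a ≡ c e a) → Newton m c → Newton m c′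
  Newton-cong c′≡c (none c≡0)     = none λ e a → trans (c′≡c e a) (c≡0 e a)
  Newton-cong c′≡c (term h r c≡)  = term h r λ e a → trans (c′≡c e a) (c≡ e a)

  Newton-suc : ∀ {m c} → Newton m c → Newton (suc m) c
  Newton-suc {m} {c} h = term h (Rational-const 0ℚ) λ e a →
    solve 2 (λ x b → x := x :+ b :* con 0ℚ) refl (c e a) (binom a m)

  Newton-term : ∀ m {p} → Rational p → Newton (suc m) (λ e a → binom a m * p e)
  Newton-term m {p} r = term (zeros m) r λ e a → sym (ℚₚ.+-identityˡ (binom a m * p e))
    where
    zeros : ∀ m → Newton m (λ _ _ → 0ℚ)
    zeros zero    = none λ _ _ → refl
    zeros (suc m) = Newton-suc (zeros m)

  Newton-+ : ∀ {m c c′} → Newton m c → Newton m c′ → Newton m (λ e a → c e a + c′ e a)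
  Newton-+ (none c≡0) (none c′≡0) = none λ e a → cong₂ _+_ (c≡0 e a) (c′≡0 e a)
  Newton-+ (term {m} {g = g} {p} h r c≡) (term {g = g′} {p′} h′ r′ c′≡) =
    term (Newton-+ h h′) (Rational-+ r r′) λ e a → trans (cong₂ _+_ (c≡ e a) (c′≡ e a))
      (solve 5 (λ x y b p q → (x :+ b :* p) :+ (y :+ b :* q) := (x :+ y) :+ b :* (p :+ q)) refl
        (g e a) (g′ e a) (binom a m) (p e) (p′ e))

  Newton-const* : ∀ {m c} q → Newton m c → Newton m (λ e a → q * c e a)
  Newton-const* q (none c≡0) = none λ e a → trans (cong (q *_) (c≡0 e a)) (ℚₚ.*-zeroʳ q)
  Newton-const* q (term {m} {g = g} {p} h r c≡) =
    term (Newton-const* q h) (Rational-* (Rational-const q) r) λ e a → trans (cong (q *_) (c≡ e a))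
      (solve 4 (λ q x b p → q :* (x :+ b :* p) := q :* x :+ b :* (q :* p)) refl q (g e a) (binom a m) (p e))

  Newton-var* : ∀ {m c} → Newton m c → Newton (suc m) (λ e a → toℚ a * c e a)
  Newton-var* (none c≡0) = Newton-suc (none λ e a → trans (cong (toℚ a *_) (c≡0 e a)) (ℚₚ.*-zeroʳ (toℚ a)))
  Newton-var* (term {m} {g = g} {p} h r c≡) =
    term (Newton-+ (Newton-var* h) (Newton-term m (Rational-* (Rational-const (toℚ m)) r)))
      (Rational-* (Rational-const (toℚ (suc m))) r) λ e a →
        trans (cong (toℚ a *_) (c≡ e a)) (trans
          (solve 4 (λ a x b p → a :* (x :+ b :* p) := a :* x :+ (a :* b) :* p) refl (toℚ a) (g e a) (binom a m) (p e))
          (trans (cong (λ x → toℚ a * g e a + x * p e) (*-binom a m))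
            (solve 6 (λ y s b⁺ i b p → y :+ (s :* b⁺ :+ i :* b) :* p := (y :+ b :* (i :* p)) :+ b⁺ :* (s :* p)) refl
              (toℚ a * g e a) (toℚ (suc m)) (binom a (suc m)) (toℚ m) (binom a m) (p e))))

  Newton-sum : ∀ {m c} (h : ℕ → ℕ) → Rational (λ e → toℚ (h e)) → Newton m c → Rational (λ e → sumTo (h e) (c e))
  Newton-sum h r (none c≡0) = Rational-cong
    (λ e → trans (sumTo-cong (h e) (c≡0 e)) (sumTo-0 (h e))) (Rational-const 0ℚ)
  Newton-sum h r (term {m} {c} {g} {p} n rp c≡) = Rational-cong sum≡
    (Rational-+ (Newton-sum h r n) (Rational-* rp (Rational-binom h r (suc m))))
    where
    open ≡-Reasoning
    sum≡ : ∀ e → sumTo (h e) (c e) ≡ sumTo (h e) (g e) + p e * binom (h e) (suc m)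
    sum≡ e = begin
      sumTo (h e) (c e)
        ≡⟨ sumTo-cong (h e) (λ a → trans (c≡ e a) (cong (g e a +_) (ℚₚ.*-comm (binom a m) (p e)))) ⟩
      sumTo (h e) (λ a → g e a + p e * binom a m)
        ≡⟨ sumTo-+ (h e) (g e) (λ a → p e * binom a m) ⟩
      sumTo (h e) (g e) + sumTo (h e) (λ a → p e * binom a m)
        ≡⟨ cong (sumTo (h e) (g e) +_) (trans (sumTo-*ˡ (h e) (p e) (λ a → binom a m)) (cong (p e *_) (sumTo-binom (h e) m))) ⟩
      sumTo (h e) (g e) + p e * binom (h e) (suc m) ∎

-- From the Newton basis and `μ` to powers of n and the values M_d(n), M_d(n+1).

module Conversion where
  open import Data.Rational using (_+_; _*_; _-_; -_)
  open ℚ-Solver using (solve; _:=_; _:+_; _:*_; _:-_; :-_; con)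
  open RationalFunctions
  open QuasiPolynomials
  open Binomials

  -- The polynomial variable is n = suc j; the index is a strict bound on the degree, as for PolyRF.
  data Polynomial : ℕ → (ℕ → ℕ → ℚ) → Set where
    none  : ∀ {P} → (∀ e j → P e j ≡ 0ℚ) → Polynomial zero P
    horner : ∀ {m P Q c} → Rational c → Polynomial m Q → (∀ e j → P e j ≡ c e + toℚ (suc j) * Q e j) → Polynomial (suc m) P

  Polynomial-cong : ∀ {m P Q} → (∀ e j → Q e j ≡ P e j) → Polynomial m P → Polynomial m Q
  Polynomial-cong Q≡P (none P≡0)      = none λ e j → trans (Q≡P e j) (P≡0 e j)
  Polynomial-cong Q≡P (horner r h P≡) = horner r h λ e j → trans (Q≡P e j) (P≡ e j)

  Polynomial-0 : ∀ m → Polynomial m (λ _ _ → 0ℚ)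
  Polynomial-0 zero    = none λ _ _ → refl
  Polynomial-0 (suc m) = horner (Rational-const 0ℚ) (Polynomial-0 m)
    λ e j → solve 1 (λ n → con 0ℚ := con 0ℚ :+ n :* con 0ℚ) refl (toℚ (suc j))

  Polynomial-suc : ∀ {m P} → Polynomial m P → Polynomial (suc m) P
  Polynomial-suc (none P≡0)      = Polynomial-cong P≡0 (Polynomial-0 1)
  Polynomial-suc (horner r h P≡) = horner r (Polynomial-suc h) P≡

  Polynomial-+ : ∀ {m P Q} → Polynomial m P → Polynomial m Q → Polynomial m (λ e j → P e j + Q e j)
  Polynomial-+ (none P≡0) (none Q≡0) = none λ e j → cong₂ _+_ (P≡0 e j) (Q≡0 e j)
  Polynomial-+ (horner {Q = P} {c} r h P≡) (horner {Q = Q} {c′} r′ h′ Q≡) =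
    horner (Rational-+ r r′) (Polynomial-+ h h′) λ e j → trans (cong₂ _+_ (P≡ e j) (Q≡ e j))
      (solve 5 (λ c c′ n p q → (c :+ n :* p) :+ (c′ :+ n :* q) := (c :+ c′) :+ n :* (p :+ q)) refl
        (c e) (c′ e) (toℚ (suc j)) (P e j) (Q e j))

  Polynomial-scale : ∀ {m P c} → Rational c → Polynomial m P → Polynomial m (λ e j → c e * P e j)
  Polynomial-scale {c = c} r (none P≡0) = none λ e j → trans (cong (c e *_) (P≡0 e j)) (ℚₚ.*-zeroʳ (c e))
  Polynomial-scale {c = c} r (horner {Q = Q} {c′} r′ h P≡) =
    horner (Rational-* r r′) (Polynomial-scale r h) λ e j → trans (cong (c e *_) (P≡ e j))
      (solve 4 (λ c c′ n q → c :* (c′ :+ n :* q) := c :* c′ :+ n :* (c :* q)) refl (c e) (c′ e) (toℚ (suc j)) (Q e j))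

  Polynomial-n* : ∀ {m P} → Polynomial m P → Polynomial (suc m) (λ e j → toℚ (suc j) * P e j)
  Polynomial-n* {P = P} h = horner (Rational-const 0ℚ) h λ e j → sym (ℚₚ.+-identityˡ (toℚ (suc j) * P e j))

  Polynomial-binom : ∀ i → Polynomial (suc i) (λ _ j → binom j i)
  Polynomial-binom zero = horner (Rational-const 1ℚ) (Polynomial-0 0) λ e j → trans (binom-0 j)
    (solve 1 (λ n → con 1ℚ := con 1ℚ :+ n :* con 0ℚ) refl (toℚ (suc j)))
  Polynomial-binom (suc i) = Polynomial-cong
    (λ e j → trans (binom-next j i) (cong (suc⁻¹ i *_) (trans
      -- The factor j - i is n - (i + 1) in the polynomial variable n = j + 1.
      (solve 3 (λ j i b → (j :- i) :* b := (con 1ℚ :+ j) :* b :+ (:- (con 1ℚ :+ i)) :* b) refl (toℚ j) (toℚ i) (binom j i))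
      (cong (λ x → x * binom j i + (- (1ℚ + toℚ i)) * binom j i) (sym (toℚ-suc j))))))
    (Polynomial-scale (Rational-const (suc⁻¹ i))
      (Polynomial-+ (Polynomial-n* (Polynomial-binom i))
                    (Polynomial-suc (Polynomial-scale (Rational-const (- (1ℚ + toℚ i))) (Polynomial-binom i)))))

  coefficients : ∀ {m P} → Polynomial m P → PolyRF m
  coefficients (none _)       = []
  coefficients (horner r h _) = fraction r ∷ coefficients h

  coefficients-defined : ∀ {m P} (h : Polynomial m P) e → AllDefinedAt (toℚ (suc e)) (coefficients h)
  coefficients-defined (none _)       e = VAll.[]
  coefficients-defined (horner r h _) e = defined r e VAll.∷ coefficients-defined h e

  coefficients-value : ∀ {m P} (h : Polynomial m P) e j →
    P e j ≡ evalPolyRF (coefficients h) (toℚ (suc j)) (toℚ (suc e)) (coefficients-defined h e)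
  coefficients-value (none P≡0)      e j = P≡0 e j
  coefficients-value (horner r h P≡) e j = trans (P≡ e j)
    (cong₂ (λ x y → x + toℚ (suc j) * y) (value-evalRF r e) (coefficients-value h e j))

  Quasi-coordinates : ∀ {m f} → Quasi m f → ∃ λ P → ∃ λ Q → Polynomial m P × Polynomial m Q ×
                      (∀ e j → f e j ≡ P e j * μ e j + Q e j * μ e (suc j))
  Quasi-coordinates (none f≡0) = _ , _ , Polynomial-0 0 , Polynomial-0 0 , λ e j → trans (f≡0 e j)
    (solve 2 (λ u v → con 0ℚ := con 0ℚ :* u :+ con 0ℚ :* v) refl (μ e j) (μ e (suc j)))
  Quasi-coordinates (term {m} {f} {g} {p} {q} h rp rq f≡) with Quasi-coordinates h
  ... | P , Q , hP , hQ , g≡ =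
    _ , _ , Polynomial-+ (Polynomial-suc hP) (Polynomial-scale rp (Polynomial-binom m))
          , Polynomial-+ (Polynomial-suc hQ) (Polynomial-scale rq (Polynomial-binom m))
          , λ e j → trans (f≡ e j) (trans (cong (_+ binom j m * combination p q e j) (g≡ e j))
              (solve 7 (λ P Q p q b u v → (P :* u :+ Q :* v) :+ b :* (p :* u :+ q :* v)
                                          := (P :+ p :* b) :* u :+ (Q :+ q :* b) :* v) refl
                (P e j) (Q e j) (p e) (q e) (binom j m) (μ e j) (μ e (suc j))))

  -- Runs the recurrence of μ backwards, from the indices j, j + 1 to j + 2, j + 3.
  Quasi-final : ∀ {m f} → Quasi m f → ∃ λ A → ∃ λ B → Polynomial m A × Polynomial m B ×
                (∀ e j → f e j ≡ A e j * toℚ (M (suc e) (suc j)) + B e j * toℚ (M (suc e) (suc (suc j))))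
  Quasi-final {f = f} h with Quasi-coordinates h
  ... | P , Q , hP , hQ , f≡ =
    -- With x and y the values of μ at j + 2 and j + 3, the recurrence gives (y - x)/d at j + 1, and
    -- then (1/d + 1/d²) x - y/d² at j.
    _ , _ , Polynomial-+ (Polynomial-scale (Rational-+ rr r) hP) (Polynomial-scale (Rational-neg r) hQ)
          , Polynomial-+ (Polynomial-scale (Rational-neg rr) hP) (Polynomial-scale r hQ)
          , λ e j → trans (f≡ e j) (trans
              (backwards (P e j) (Q e j) (d⁻¹ e) (toℚ (suc e)) (μ e j) (μ e (suc j)) (reciprocal-inverse (λ e → e) e))
              (cong₂ (λ x y → ((d⁻¹ e * d⁻¹ e + d⁻¹ e) * P e j + (- d⁻¹ e) * Q e j) * x
                            + ((- (d⁻¹ e * d⁻¹ e)) * P e j + d⁻¹ e * Q e j) * y)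
                (trans (sym (μ-step e j)) (μ-suc e (suc j)))
                (trans (cong (_+ toℚ (suc e) * μ e (suc j)) (sym (μ-step e j)))
                  (trans (sym (μ-step e (suc j))) (μ-suc e (suc (suc j)))))))
    where
    r  = Rational-d⁻¹
    rr = Rational-* Rational-d⁻¹ Rational-d⁻¹
    backwards : ∀ P Q r d u v → r * d ≡ 1ℚ → P * u + Q * v ≡
      ((r * r + r) * P + (- r) * Q) * (v + d * u) + ((- (r * r)) * P + r * Q) * ((v + d * u) + d * v)
    backwards P Q r d u v rd≡1 = sym (trans
      (solve 6 (λ P Q r d u v →
          ((r :* r :+ r) :* P :+ (:- r) :* Q) :* (v :+ d :* u) :+ ((:- (r :* r)) :* P :+ r :* Q) :* ((v :+ d :* u) :+ d :* v)
          := P :* (r :* v :+ (r :* d) :* u :- (r :* d) :* (r :* v)) :+ Q :* ((r :* d) :* v)) refl P Q r d u v)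
      (trans (cong (λ x → P * (r * v + x * u - x * (r * v)) + Q * (x * v)) rd≡1)
        (solve 5 (λ P Q r u v → P :* (r :* v :+ con 1ℚ :* u :- con 1ℚ :* (r :* v)) :+ Q :* (con 1ℚ :* v)
                                := P :* u :+ Q :* v) refl P Q r u v)))

-- Weighted polynomials in the statistics of a word, and their behaviour under translations.

module Statistics where
  open import Data.Rational using (_+_; _*_; _-_; -_)
  open ℚ-Solver using (solve; _:=_; _:+_; _:*_; _:-_; con)
  open RationalFunctions
  open QuasiPolynomials
  open Binomials

  -- In order: the length of the word plus one, Σ i a_i, Σ C(a_i,2) and Σ a_i. The extra one in the
  -- first matches the indexing of `words`.
  record State : Set where
    constructor ⟨_,_,_,_⟩
    field
      indexₛ momentₛ pairsₛ totalₛ : ℚ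

  open State

  data Variable : Set where
    index moment pairs total : Variable

  read : Variable → State → ℚ
  read index  = indexₛ
  read moment = momentₛ
  read pairs  = pairsₛ
  read total  = totalₛ

  -- The weight of a variable, minus one.
  excess : Variable → ℕ
  excess moment = 1
  excess _      = 0

  -- The index is a strict bound on the weight, so that only 0 has index 0.
  data Weighted {Θ : Set} (K : (Θ → ℚ) → Set) : ℕ → (Θ → State → ℚ) → Set where
    none  : ∀ {m φ} → (∀ θ s → φ θ s ≡ 0ℚ) → Weighted K m φ
    const : ∀ {m φ c} → K c → (∀ θ s → φ θ s ≡ c θ) → Weighted K (suc m) φ
    plus  : ∀ {m φ ψ χ} → Weighted K m φ → Weighted K m ψ → (∀ θ s → χ θ s ≡ φ θ s + ψ θ s) → Weighted K m χ
    times : ∀ {m φ χ} v → Weighted K m φ → (∀ θ s → χ θ s ≡ read v s * φ θ s) → Weighted K (suc (excess v ℕ.+ m)) χ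

  module _ {Θ : Set} {K : (Θ → ℚ) → Set} where

    Weighted-cong : ∀ {m φ ψ} → (∀ θ s → ψ θ s ≡ φ θ s) → Weighted K m φ → Weighted K m ψ
    Weighted-cong eq (none φ≡)       = none λ θ s → trans (eq θ s) (φ≡ θ s)
    Weighted-cong eq (const c φ≡)    = const c λ θ s → trans (eq θ s) (φ≡ θ s)
    Weighted-cong eq (plus h k φ≡)   = plus h k λ θ s → trans (eq θ s) (φ≡ θ s)
    Weighted-cong eq (times v h φ≡)  = times v h λ θ s → trans (eq θ s) (φ≡ θ s)

    Weighted-suc : ∀ {m φ} → Weighted K m φ → Weighted K (suc m) φ
    Weighted-suc (none φ≡)          = none φ≡
    Weighted-suc (const c φ≡)       = const c φ≡
    Weighted-suc (plus h k φ≡)      = plus (Weighted-suc h) (Weighted-suc k) φ≡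
    Weighted-suc (times {m} {χ = χ} v h φ≡) = subst (λ k → Weighted K (suc k) χ) (ℕₚ.+-suc (excess v) m)
      (times v (Weighted-suc h) φ≡)

    Weighted-zero : ∀ {φ} → Weighted K 0 φ → ∀ θ s → φ θ s ≡ 0ℚ
    Weighted-zero (none φ≡)     θ s = φ≡ θ s
    Weighted-zero (plus h k φ≡) θ s = trans (φ≡ θ s) (cong₂ _+_ (Weighted-zero h θ s) (Weighted-zero k θ s))

    Multiplier : (Θ → ℚ) → Set
    Multiplier κ = ∀ {c} → K c → K (λ θ → κ θ * c θ)

    Weighted-scale : ∀ {m φ} (κ : Θ → ℚ) → Multiplier κ → Weighted K m φ → Weighted K m (λ θ s → κ θ * φ θ s)
    Weighted-scale κ mκ (none φ≡)    = none λ θ s → trans (cong (κ θ *_) (φ≡ θ s)) (ℚₚ.*-zeroʳ (κ θ))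
    Weighted-scale κ mκ (const c φ≡) = const (mκ c) λ θ s → cong (κ θ *_) (φ≡ θ s)
    Weighted-scale κ mκ (plus {φ = φ} {ψ} h k φ≡) = plus (Weighted-scale κ mκ h) (Weighted-scale κ mκ k) λ θ s →
      trans (cong (κ θ *_) (φ≡ θ s)) (ℚₚ.*-distribˡ-+ (κ θ) (φ θ s) (ψ θ s))
    Weighted-scale κ mκ (times {φ = φ} v h φ≡) = times v (Weighted-scale κ mκ h) λ θ s →
      trans (cong (κ θ *_) (φ≡ θ s))
        (solve 3 (λ x y z → x :* (y :* z) := y :* (x :* z)) refl (κ θ) (read v s) (φ θ s))

    -- The parameter θ is d alone when a zero is prepended, and d together with the entry otherwise.
    -- The class K of coefficients differs accordingly, so it is only required to absorb the four
    -- shifts as factors.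
    record Translation : Set where
      field
        α β γ δ : Θ → ℚ
        α-multiplier : Multiplier α
        β-multiplier : Multiplier β
        γ-multiplier : Multiplier γ
        δ-multiplier : Multiplier δ

      translate : Θ → State → State
      translate θ ⟨ i , x , y , z ⟩ = ⟨ i + α θ , x + β θ * i , y + γ θ , z + δ θ ⟩

      increment : Variable → Θ → State → ℚ
      increment index  θ s = α θ
      increment moment θ s = β θ * indexₛ s
      increment pairs  θ s = γ θ
      increment total  θ s = δ θ

      read-translate : ∀ v θ s → read v (translate θ s) ≡ read v s + increment v θ s
      read-translate index  θ s = refl
      read-translate moment θ s = refl
      read-translate pairs  θ s = refl
      read-translate total  θ s = refl

      Weighted-increment* : ∀ {m φ} v → Weighted K m φ → Weighted K (excess v ℕ.+ m) (λ θ s → increment v θ s * φ θ s)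
      Weighted-increment* index  h = Weighted-scale α α-multiplier h
      Weighted-increment* pairs  h = Weighted-scale γ γ-multiplier h
      Weighted-increment* total  h = Weighted-scale δ δ-multiplier h
      Weighted-increment* {φ = φ} moment h = Weighted-cong
        (λ θ s → solve 3 (λ b i x → b :* i :* x := i :* (b :* x)) refl (β θ) (indexₛ s) (φ θ s))
        (times index (Weighted-scale β β-multiplier h) (λ _ _ → refl))

      difference : (Θ → State → ℚ) → Θ → State → ℚ
      difference φ θ s = φ θ (translate θ s) - φ θ s

      -- Translations lower the weight: only the moment moves by a variable, and that one is lighter.
      Weighted-difference : ∀ {m φ} → Weighted K m φ → Weighted K (pred m) (difference φ)
      Weighted-difference (none φ≡) = none λ θ s → cong₂ _-_ (φ≡ θ (translate θ s)) (φ≡ θ s)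
      Weighted-difference (const {c = c} _ φ≡) = none λ θ s →
        trans (cong₂ _-_ (φ≡ θ (translate θ s)) (φ≡ θ s)) (ℚₚ.+-inverseʳ (c θ))
      Weighted-difference (plus {φ = φ} {ψ} h k φ≡) = plus (Weighted-difference h) (Weighted-difference k) λ θ s →
        trans (cong₂ _-_ (φ≡ θ (translate θ s)) (φ≡ θ s))
          (solve 4 (λ a b c d → (a :+ b) :- (c :+ d) := (a :- c) :+ (b :- d)) refl
            (φ θ (translate θ s)) (ψ θ (translate θ s)) (φ θ s) (ψ θ s))
      -- A factor of index 0 vanishes identically; its index cannot be lowered any further, so the
      -- product rule below does not apply.
      Weighted-difference (times {zero} {φ} v h φ≡) = none λ θ s → cong₂ _-_ (vanish θ (translate θ s)) (vanish θ s)
        where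
        vanish = λ θ s → trans (φ≡ θ s) (trans (cong (read v s *_) (Weighted-zero h θ s)) (ℚₚ.*-zeroʳ (read v s)))
      -- Product rule Δ(xφ) = x Δφ + Δx (φ + Δφ). In the first summand the factor φ got lighter, in
      -- the second the variable did.
      Weighted-difference (times {suc m} {φ} {χ} v h φ≡) = plus
        (subst (λ k → Weighted K k (λ θ s → read v s * difference φ θ s)) (sym (ℕₚ.+-suc (excess v) m))
          (times v (Weighted-difference h) (λ _ _ → refl)))
        (Weighted-increment* v (plus h (Weighted-suc (Weighted-difference h)) (λ _ _ → refl)))
        λ θ s → trans (cong₂ _-_ (trans (φ≡ θ (translate θ s)) (cong (_* φ θ (translate θ s)) (read-translate v θ s))) (φ≡ θ s))
          (solve 4 (λ x d p q → (x :+ d) :* p :- x :* q := x :* (p :- q) :+ d :* (q :+ (p :- q))) refl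
            (read v s) (increment v θ s) (φ θ (translate θ s)) (φ θ s))

      Weighted-translate : ∀ {m φ} → Weighted K m φ → Weighted K m (λ θ s → φ θ (translate θ s))
      Weighted-translate {zero}  h = none λ θ s → Weighted-zero h θ (translate θ s)
      Weighted-translate {suc m} {φ} h = plus h (Weighted-suc (Weighted-difference h)) λ θ s →
        solve 2 (λ p q → p := q :+ (p :- q)) refl (φ θ (translate θ s)) (φ θ s)

  -- The degree in the entry is left existential: summation turns it into a degree in d, on which no
  -- bound is claimed.
  RationalNewton : (ℕ × ℕ → ℚ) → Set
  RationalNewton c = ∃ λ m → Newton m (λ e a → c (e , a))

  Weighted-value : ∀ {m φ} → Weighted Rational m φ → ∀ s → Rational (λ e → φ e s)
  Weighted-value (none φ≡)      s = Rational-cong (λ e → φ≡ e s) (Rational-const 0ℚ)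
  Weighted-value (const r φ≡)   s = Rational-cong (λ e → φ≡ e s) r
  Weighted-value (plus h k φ≡)  s = Rational-cong (λ e → φ≡ e s) (Rational-+ (Weighted-value h s) (Weighted-value k s))
  Weighted-value (times v h φ≡) s = Rational-cong (λ e → φ≡ e s)
    (Rational-* (Rational-const (read v s)) (Weighted-value h s))

  Weighted-embed : ∀ {m φ} → Weighted Rational m φ → Weighted RationalNewton m (λ (θ : ℕ × ℕ) s → φ (proj₁ θ) s)
  Weighted-embed (none φ≡)      = none λ θ s → φ≡ (proj₁ θ) s
  Weighted-embed (const {c = c} r φ≡)   = const (1 , Newton-cong
      (λ e a → sym (trans (cong (_* c e) (binom-0 a)) (ℚₚ.*-identityˡ (c e)))) (Newton-term 0 r))
    λ θ s → φ≡ (proj₁ θ) s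
  Weighted-embed (plus h k φ≡)  = plus (Weighted-embed h) (Weighted-embed k) λ θ s → φ≡ (proj₁ θ) s
  Weighted-embed (times v h φ≡) = times v (Weighted-embed h) λ θ s → φ≡ (proj₁ θ) s

  -- The entry occurs in the coefficients only, so summing over it leaves the weight alone.
  Weighted-sum : ∀ {m φ} (h : ℕ → ℕ) → Rational (λ e → toℚ (h e)) → Weighted RationalNewton m φ →
                 Weighted Rational m (λ e s → sumTo (h e) (λ a → φ (e , a) s))
  Weighted-sum h r (none φ≡) = none λ e s →
    trans (sumTo-cong (h e) (λ a → φ≡ (e , a) s)) (sumTo-0 (h e))
  Weighted-sum h r (const (_ , n) φ≡) = const (Newton-sum h r n) λ e s → sumTo-cong (h e) (λ a → φ≡ (e , a) s)
  Weighted-sum h r (plus {φ = φ} {ψ} p q φ≡) = plus (Weighted-sum h r p) (Weighted-sum h r q) λ e s →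
    trans (sumTo-cong (h e) (λ a → φ≡ (e , a) s)) (sumTo-+ (h e) (λ a → φ (e , a) s) (λ a → ψ (e , a) s))
  Weighted-sum h r (times {φ = φ} v p φ≡) = times v (Weighted-sum h r p) λ e s →
    trans (sumTo-cong (h e) (λ a → φ≡ (e , a) s)) (sumTo-*ˡ (h e) (read v s) (λ a → φ (e , a) s))

  prepend-zero : Translation {K = Rational}
  prepend-zero = record
    { α = λ _ → 1ℚ ; β = λ _ → 0ℚ ; γ = λ _ → 0ℚ ; δ = λ _ → 0ℚ
    ; α-multiplier = Rational-* (Rational-const 1ℚ)
    ; β-multiplier = Rational-* (Rational-const 0ℚ)
    ; γ-multiplier = Rational-* (Rational-const 0ℚ)
    ; δ-multiplier = Rational-* (Rational-const 0ℚ)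
    }

  -- The parameter a stands for the entry a + 1, followed by the zero that separates it from the old
  -- word; hence the shift of the length by 2. The new entry sits at position length + 1, which is
  -- the old index, and C(a+1,2) = a (a + 1)/2.
  prepend-entry : Translation {K = RationalNewton}
  prepend-entry = record
    { α = λ _ → toℚ 2
    ; β = λ θ → 1ℚ + toℚ (proj₂ θ)
    ; γ = λ θ → suc⁻¹ 1 * (toℚ (proj₂ θ) * (1ℚ + toℚ (proj₂ θ)))
    ; δ = λ θ → 1ℚ + toℚ (proj₂ θ)
    ; α-multiplier = λ (m , n) → m , Newton-const* (toℚ 2) n
    ; β-multiplier = λ (m , n) → suc m , suc-multiplier n
    ; γ-multiplier = λ {c} (m , n) → suc (suc m) , Newton-cong
        (λ e a → solve 4 (λ r a b c → r :* (a :* b) :* c := r :* (a :* (b :* c))) refl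
          (suc⁻¹ 1) (toℚ a) (1ℚ + toℚ a) (c (e , a)))
        (Newton-const* (suc⁻¹ 1) (Newton-var* (suc-multiplier n)))
    ; δ-multiplier = λ (m , n) → suc m , suc-multiplier n
    }
    where
    suc-multiplier : ∀ {m c} → Newton m c → Newton (suc m) (λ e a → (1ℚ + toℚ a) * c e a)
    suc-multiplier {c = c} n = Newton-cong
      (λ e a → solve 2 (λ a x → (con 1ℚ :+ a) :* x := x :+ a :* x) refl (toℚ a) (c e a))
      (Newton-+ (Newton-suc n) (Newton-var* n))

-- The words a_{n-1} ⋯ a₀ and their statistics.

module Words where
  -- A word a_{n−1} ⋯ a₁ a₀ records the numbers of elements in the residue classes modulo n of the beta-set of a core.
  -- words d (suc n) lists the words of length n with a₀ = 0, entries at most d and no two adjacent nonzero entries.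
  -- Starting one step earlier, at words d 0 = [], makes the recurrence hold from the start.
  extend : ℕ → List (List ℕ) → List (List ℕ)
  extend zero    W = []
  extend (suc h) W = map (λ w → suc h ∷ 0 ∷ w) W ++ extend h W

  words : ℕ → ℕ → List (List ℕ)
  words d zero          = []
  words d (suc zero)    = [] ∷ []
  words d (suc (suc j)) = map (0 ∷_) (words d (suc j)) ++ extend d (words d j)

  -- The words of length suc j whose leading entry is at most h.
  headBounded : ℕ → ℕ → ℕ → List (List ℕ)
  headBounded h d j = map (0 ∷_) (words d (suc j)) ++ extend h (words d j)

  momentOf : List ℕ → ℕ
  momentOf []      = 0
  momentOf (a ∷ w) = length w ℕ.* a ℕ.+ momentOf w

  pairsOf : List ℕ → ℕ
  pairsOf []      = 0
  pairsOf (a ∷ w) = a C 2 ℕ.+ pairsOf w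

  words-length : ∀ d j → All (λ w → suc (length w) ≡ j) (words d j)
  words-length d zero          = []
  words-length d (suc zero)    = refl ∷ []
  words-length d (suc (suc j)) = Allₚ.++⁺ (Allₚ.map⁺ (All.map (cong suc) (words-length d (suc j)))) (extended d)
    where
    extended : ∀ h → All (λ w → suc (length w) ≡ 2 ℕ.+ j) (extend h (words d j))
    extended zero    = []
    extended (suc h) = Allₚ.++⁺ (Allₚ.map⁺ (All.map (cong (2 ℕ.+_)) (words-length d j))) (extended h)

-- Sums of weighted polynomials over words.

module WordSums where
  open import Data.Rational using (_+_; _*_; _-_; -_)
  open ℚ-Solver using (solve; _:=_; _:+_; _:*_; _:-_; con)
  open RationalFunctions
  open QuasiPolynomials
  open Binomials
  open Statistics
  open Words

  sumOver : {A : Set} → List A → (A → ℚ) → ℚ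
  sumOver []       f = 0ℚ
  sumOver (x ∷ xs) f = f x + sumOver xs f

  module _ {A : Set} where

    sumOver-++ : (xs ys : List A) (f : A → ℚ) → sumOver (xs ++ ys) f ≡ sumOver xs f + sumOver ys f
    sumOver-++ []       ys f = sym (ℚₚ.+-identityˡ (sumOver ys f))
    sumOver-++ (x ∷ xs) ys f = trans (cong (f x +_) (sumOver-++ xs ys f)) (sym (ℚₚ.+-assoc (f x) (sumOver xs f) (sumOver ys f)))

    sumOver-map : ∀ {B : Set} (g : A → B) (xs : List A) (f : B → ℚ) → sumOver (map g xs) f ≡ sumOver xs (λ x → f (g x))
    sumOver-map g []       f = refl
    sumOver-map g (x ∷ xs) f = cong (f (g x) +_) (sumOver-map g xs f)

    sumOver-cong : ∀ {xs : List A} {f g : A → ℚ} → All (λ x → f x ≡ g x) xs → sumOver xs f ≡ sumOver xs g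
    sumOver-cong []       = refl
    sumOver-cong (p ∷ ps) = cong₂ _+_ p (sumOver-cong ps)

    sumOver-+ : (xs : List A) (f g : A → ℚ) → sumOver xs (λ x → f x + g x) ≡ sumOver xs f + sumOver xs g
    sumOver-+ []       f g = refl
    sumOver-+ (x ∷ xs) f g = trans (cong (f x + g x +_) (sumOver-+ xs f g))
      (solve 4 (λ a b c d → a :+ b :+ (c :+ d) := (a :+ c) :+ (b :+ d)) refl (f x) (g x) (sumOver xs f) (sumOver xs g))

    sumOver-0 : (xs : List A) → sumOver xs (λ _ → 0ℚ) ≡ 0ℚ
    sumOver-0 []       = refl
    sumOver-0 (x ∷ xs) = trans (ℚₚ.+-identityˡ _) (sumOver-0 xs)

    sumOver-*ˡ : (xs : List A) (c : ℚ) (f : A → ℚ) → sumOver xs (λ x → c * f x) ≡ c * sumOver xs f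
    sumOver-*ˡ []       c f = sym (ℚₚ.*-zeroʳ c)
    sumOver-*ˡ (x ∷ xs) c f = trans (cong (c * f x +_) (sumOver-*ˡ xs c f)) (sym (ℚₚ.*-distribˡ-+ c (f x) (sumOver xs f)))

  state : ℕ → List ℕ → State
  state j w = ⟨ toℚ j , toℚ (momentOf w) , toℚ (pairsOf w) , toℚ (sum w) ⟩

  ⟨⟩-cong : ∀ {i i′ x x′ y y′ z z′} → i ≡ i′ → x ≡ x′ → y ≡ y′ → z ≡ z′ → ⟨ i , x , y , z ⟩ ≡ ⟨ i′ , x′ , y′ , z′ ⟩
  ⟨⟩-cong refl refl refl refl = refl

  open Translation

  state-zero : ∀ e j w → state (suc j) (0 ∷ w) ≡ translate prepend-zero e (state j w)
  state-zero e j w = ⟨⟩-cong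
    (trans (toℚ-suc j) (ℚₚ.+-comm 1ℚ (toℚ j)))
    (trans (cong (λ x → toℚ (x ℕ.+ momentOf w)) (ℕₚ.*-zeroʳ (length w)))
      (solve 2 (λ x i → x := x :+ con 0ℚ :* i) refl (toℚ (momentOf w)) (toℚ j)))
    (sym (ℚₚ.+-identityʳ (toℚ (pairsOf w))))
    (sym (ℚₚ.+-identityʳ (toℚ (sum w))))

  state-entry : ∀ e a j w → suc (length w) ≡ j →
                state (suc (suc j)) (suc a ∷ 0 ∷ w) ≡ translate prepend-entry (e , a) (state j w)
  state-entry e a j w refl = ⟨⟩-cong
    (trans (toℚ-+ 2 j) (ℚₚ.+-comm (toℚ 2) (toℚ j)))
    (trans (cong (λ x → toℚ (j ℕ.* suc a ℕ.+ (x ℕ.+ momentOf w))) (ℕₚ.*-zeroʳ (length w)))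
      (trans (toℚ-+ (j ℕ.* suc a) (momentOf w))
        (trans (cong (_+ toℚ (momentOf w)) (trans (toℚ-* j (suc a)) (cong (toℚ j *_) (toℚ-suc a))))
          (solve 3 (λ i a x → i :* (con 1ℚ :+ a) :+ x := x :+ (con 1ℚ :+ a) :* i) refl
            (toℚ j) (toℚ a) (toℚ (momentOf w))))))
    (trans (toℚ-+ (suc a C 2) (pairsOf w)) (trans (cong (_+ toℚ (pairsOf w)) (binom-suc-2 a)) (ℚₚ.+-comm _ (toℚ (pairsOf w)))))
    (trans (toℚ-+ (suc a) (sum w)) (trans (cong (_+ toℚ (sum w)) (toℚ-suc a)) (ℚₚ.+-comm (1ℚ + toℚ a) (toℚ (sum w)))))

  Statistic : Set
  Statistic = ℕ → State → ℚ

  wordSum : Statistic → ℕ → ℕ → ℚ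
  wordSum φ e j = sumOver (words (suc e) j) (λ w → φ e (state j w))

  boundedSum : (ℕ → ℕ) → Statistic → ℕ → ℕ → ℚ
  boundedSum h φ e j = sumOver (headBounded (h e) (suc e) j) (λ w → φ e (state (suc (suc j)) w))

  afterZero : Statistic → Statistic
  afterZero φ e s = φ e (translate prepend-zero e s)

  afterEntry : Statistic → ℕ × ℕ → State → ℚ
  afterEntry φ θ s = φ (proj₁ θ) (translate prepend-entry θ s)

  afterEntries : (ℕ → ℕ) → Statistic → Statistic
  afterEntries h φ e s = sumTo (h e) (λ a → afterEntry φ (e , a) s)

  extend-sum : ∀ φ e h j → sumOver (extend h (words (suc e) j)) (λ w → φ e (state (suc (suc j)) w)) ≡
               wordSum (λ e s → sumTo h (λ a → afterEntry φ (e , a) s)) e j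
  extend-sum φ e zero    j = sym (sumOver-0 (words (suc e) j))
  extend-sum φ e (suc h) j = begin
    sumOver (map (λ w → suc h ∷ 0 ∷ w) W ++ extend h W) f
      ≡⟨ sumOver-++ (map (λ w → suc h ∷ 0 ∷ w) W) (extend h W) f ⟩
    sumOver (map (λ w → suc h ∷ 0 ∷ w) W) f + sumOver (extend h W) f
      ≡⟨ cong₂ _+_ (trans (sumOver-map (λ w → suc h ∷ 0 ∷ w) W f)
           (sumOver-cong (All.map (λ {w} l → cong (φ e) (state-entry e h j w l)) (words-length (suc e) j))))
           (extend-sum φ e h j) ⟩
    sumOver W (λ w → afterEntry φ (e , h) (state j w)) + sumOver W (λ w → sumTo h (λ a → afterEntry φ (e , a) (state j w)))
      ≡⟨ sumOver-+ W (λ w → afterEntry φ (e , h) (state j w)) (λ w → sumTo h (λ a → afterEntry φ (e , a) (state j w))) ⟨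
    sumOver W (λ w → afterEntry φ (e , h) (state j w) + sumTo h (λ a → afterEntry φ (e , a) (state j w))) ∎
    where
    open ≡-Reasoning
    W = words (suc e) j
    f : List ℕ → ℚ
    f w = φ e (state (suc (suc j)) w)

  boundedSum-split : ∀ h φ e j → boundedSum h φ e j ≡ wordSum (afterZero φ) e (suc j) + wordSum (afterEntries h φ) e j
  boundedSum-split h φ e j = trans (sumOver-++ (map (0 ∷_) (words (suc e) (suc j))) (extend (h e) (words (suc e) j)) f)
    (cong₂ _+_
      (trans (sumOver-map (0 ∷_) (words (suc e) (suc j)) f)
        (sumOver-cong (All.universal (λ w → cong (φ e) (state-zero e (suc j) w)) (words (suc e) (suc j)))))
      (extend-sum φ e (h e) j))
    where
    f : List ℕ → ℚ
    f w = φ e (state (suc (suc j)) w)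

  sumTo-const : ∀ n q → sumTo n (λ _ → q) ≡ toℚ n * q
  sumTo-const zero    q = sym (ℚₚ.*-zeroˡ q)
  sumTo-const (suc n) q = trans (cong (q +_) (sumTo-const n q))
    (trans (solve 2 (λ n q → q :+ n :* q := (con 1ℚ :+ n) :* q) refl (toℚ n) q) (cong (_* q) (sym (toℚ-suc n))))

  -- Induction on the weight. Replacing φ after a translation by φ plus its difference, the zero
  -- contributes one copy of the sum at j + 1 and the nonzero entries d copies at j, which is the
  -- recurrence of M_d. The differences are lighter and form the right-hand side.
  Quasi-wordSum : ∀ m {φ} → Weighted Rational m φ → Quasi m (wordSum φ)
  Quasi-wordSum zero h = none λ e j →
    trans (sumOver-cong (All.universal (λ w → Weighted-zero h e (state j w)) (words (suc e) j))) (sumOver-0 (words (suc e) j))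
  Quasi-wordSum (suc m) {φ} h = Quasi-recurrence
    -- There are no words at index 0, and only the empty word at index 1.
    (Rational-const 0ℚ)
    (Rational-cong (λ e → ℚₚ.+-identityʳ (φ e (state 1 []))) (Weighted-value h (state 1 [])))
    (Quasi-+ (Quasi-shift (Quasi-wordSum m Δ₀)) (Quasi-wordSum m Δ₁))
    recurrence
    where
    φ₀ : Statistic
    φ₀ = difference prepend-zero φ
    φ₁ : Statistic
    φ₁ e s = sumTo (suc e) (λ a → difference prepend-entry (λ θ → φ (proj₁ θ)) (e , a) s)
    Δ₀ : Weighted Rational m φ₀
    Δ₀ = Weighted-difference prepend-zero h
    Δ₁ : Weighted Rational m φ₁
    Δ₁ = Weighted-sum suc Rational-d (Weighted-difference prepend-entry (Weighted-embed h))

    zero-part : ∀ e j → wordSum (afterZero φ) e j ≡ wordSum φ e j + wordSum φ₀ e j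
    zero-part e j = trans
      (sumOver-cong (All.universal
        (λ w → solve 2 (λ p q → p := q :+ (p :- q)) refl (afterZero φ e (state j w)) (φ e (state j w))) (words (suc e) j)))
      (sumOver-+ (words (suc e) j) (λ w → φ e (state j w)) (λ w → φ₀ e (state j w)))

    entry-split : ∀ e s → afterEntries suc φ e s ≡ toℚ (suc e) * φ e s + φ₁ e s
    entry-split e s = trans
      (sumTo-cong (suc e) (λ a → solve 2 (λ p q → p := q :+ (p :- q)) refl (afterEntry φ (e , a) s) (φ e s)))
      (trans (sumTo-+ (suc e) (λ _ → φ e s) (λ a → afterEntry φ (e , a) s - φ e s))
        (cong (_+ φ₁ e s) (sumTo-const (suc e) (φ e s))))

    entry-part : ∀ e j → wordSum (afterEntries suc φ) e j ≡ toℚ (suc e) * wordSum φ e j + wordSum φ₁ e j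
    entry-part e j = trans
      (sumOver-cong (All.universal (λ w → entry-split e (state j w)) (words (suc e) j)))
      (trans (sumOver-+ (words (suc e) j) (λ w → toℚ (suc e) * φ e (state j w)) (λ w → φ₁ e (state j w)))
        (cong (_+ wordSum φ₁ e j) (sumOver-*ˡ (words (suc e) j) (toℚ (suc e)) (λ w → φ e (state j w)))))

    recurrence : Recurrence (wordSum φ) (λ e j → wordSum φ₀ e (suc j) + wordSum φ₁ e j)
    -- For the bound h = d the list `headBounded` is by definition `words` at index j + 2.
    recurrence e j = trans (boundedSum-split suc φ e j) (trans (cong₂ _+_ (zero-part e (suc j)) (entry-part e j))
      (solve 4 (λ a b c d → (a :+ b) :+ (c :+ d) := a :+ c :+ (b :+ d)) refl
        (wordSum φ e (suc j)) (wordSum φ₀ e (suc j)) (toℚ (suc e) * wordSum φ e j) (wordSum φ₁ e j)))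

  -- The bound h concerns the leading entry alone, so no new recurrence has to be solved: splitting
  -- off that entry leaves unrestricted word sums, and translations preserve the weight bound.
  Quasi-boundedSum : ∀ {m φ} (h : ℕ → ℕ) → Rational (λ e → toℚ (h e)) → Weighted Rational m φ → Quasi m (boundedSum h φ)
  Quasi-boundedSum {m} {φ} h r k = Quasi-cong (boundedSum-split h φ)
    (Quasi-+ (Quasi-shift (Quasi-wordSum m (Weighted-translate prepend-zero k)))
             (Quasi-wordSum m (Weighted-sum h r (Weighted-translate prepend-entry (Weighted-embed k)))))

  power : ℚ → ℕ → ℚ
  power q zero    = 1ℚ
  power q (suc k) = q * power q k

  toℚ-^ : ∀ n k → toℚ (n ℕ.^ k) ≡ power (toℚ n) k
  toℚ-^ n zero    = refl
  toℚ-^ n (suc k) = trans (toℚ-* n (n ℕ.^ k)) (cong (toℚ n *_) (toℚ-^ n k))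

  -- The size of the partition of a word: the sum of its beta-set minus C(ℓ,2), where ℓ is the number of parts.
  sizeOf : State → ℚ
  sizeOf ⟨ i , x , y , z ⟩ = x + (i - 1ℚ) * y - ½ * (z * (z - 1ℚ))

  -- The monomials x, i y and z² weigh exactly 2, while y and z weigh 1. This 2 is the factor in the
  -- degree bound 2k.
  Weighted-size* : ∀ {m φ} → Weighted Rational m φ → Weighted Rational (suc (suc m)) (λ e s → sizeOf s * φ e s)
  Weighted-size* {φ = φ} h = plus
    (times moment h (λ _ _ → refl))
    (plus (times index (times pairs h (λ _ _ → refl)) (λ _ _ → refl))
      (plus (Weighted-suc (times pairs (scaled (- 1ℚ)) (λ _ _ → refl)))
        (plus (times total (times total (scaled (- ½)) (λ _ _ → refl)) (λ _ _ → refl))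
              (Weighted-suc (times total (scaled ½) (λ _ _ → refl)))
          (λ _ _ → refl))
        (λ _ _ → refl))
      (λ _ _ → refl))
    λ e s → solve 5 (λ i x y z f →
        (x :+ (i :- con 1ℚ) :* y :- con ½ :* (z :* (z :- con 1ℚ))) :* f :=
        x :* f :+ (i :* (y :* f) :+ (y :* (con (- 1ℚ) :* f) :+ (z :* (z :* (con (- ½) :* f)) :+ z :* (con ½ :* f))))) refl
      (State.indexₛ s) (State.momentₛ s) (State.pairsₛ s) (State.totalₛ s) (φ e s)
    where
    scaled : ∀ q → Weighted Rational _ (λ e s → q * φ e s)
    scaled q = Weighted-scale (λ _ → q) (Rational-* (Rational-const q)) h

  Weighted-sizePower : ∀ k → Weighted Rational (1 ℕ.+ 2 ℕ.* k) (λ _ s → power (sizeOf s) k)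
  Weighted-sizePower zero    = const (Rational-const 1ℚ) (λ _ _ → refl)
  Weighted-sizePower (suc k) = subst (λ m → Weighted Rational m (λ _ s → power (sizeOf s) (suc k)))
    (cong suc (sym (ℕₚ.*-distribˡ-+ 2 1 k))) (Weighted-size* (Weighted-sizePower k))

open import Data.Nat using (_+_; _*_; _∸_; _≤_; _<_; _>_; z≤n; s≤s; z<s; _≤?_)
open import Data.Nat.Properties
open import Data.Nat.DivMod using (_/_; _%_; m≡m%n+[m/n]*n; m%n<n; m<n*o⇒m/o<n)
open import Data.Nat.Divisibility using (_∣_; divides; ∣-refl)
open import Data.Nat.ListAction.Properties using (sum-++)
open import Data.Nat.Solver using () renaming (module +-*-Solver to ℕ-Solver)
open import Data.Sum using (_⊎_; inj₁; inj₂)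
open import Data.Unit using (⊤; tt)
open import Data.List.Properties using (filter-accept; filter-reject; length-map; length-++; ∷-injectiveˡ; ∷-injectiveʳ)
open import Data.List.Relation.Unary.Any using (here; there)
open import Data.List.Relation.Unary.AllPairs as AllPairs using (AllPairs; []; _∷_)
import Data.List.Relation.Unary.AllPairs.Properties as AllPairsₚ
open import Data.List.Relation.Unary.Linked using (Linked; []; [-]; _∷_)
import Data.List.Relation.Unary.Linked.Properties as Linkedₚ
open import Data.List.Relation.Unary.Unique.Propositional using (Unique)
import Data.List.Relation.Unary.Unique.Propositional.Properties as Uniqueₚ
open import Data.List.Membership.Propositional using (_∈_; _∉_)
open import Data.List.Membership.Propositional.Properties using (∈-map⁺; ∈-map⁻; ∈-++⁺ˡ; ∈-++⁺ʳ; ∈-++⁻)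
open import Data.List.Membership.DecPropositional ℕ._≟_ using (_∈?_)
open import Function.Base using (_∘_)
open import Function.Bundles using (_⇔_; mk⇔)
open import Relation.Nullary using (¬_; yes; no; contradiction)
open import Relation.Unary using (Decidable)
open import Relation.Binary.Definitions using (tri<; tri≈; tri>)

-- Beta-sets of partitions with distinct parts.

module BetaSets where

  Decreasing : List ℕ → Set
  Decreasing = AllPairs _>_

  Linked⇒Decreasing : ∀ {xs} → Linked _>_ xs → Decreasing xs
  Linked⇒Decreasing = Linkedₚ.Linked⇒AllPairs λ x>y y>z → <-trans y>z x>y

  -- The first-column hook lengths.
  beta : List ℕ → List ℕ
  beta []       = []
  beta (r ∷ rs) = r + length rs ∷ beta rs

  unbeta : List ℕ → List ℕ
  unbeta []       = []
  unbeta (b ∷ bs) = b ∸ length bs ∷ unbeta bs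

  length-beta : ∀ p → length (beta p) ≡ length p
  length-beta []       = refl
  length-beta (r ∷ rs) = cong suc (length-beta rs)

  length-unbeta : ∀ bs → length (unbeta bs) ≡ length bs
  length-unbeta []       = refl
  length-unbeta (b ∷ bs) = cong suc (length-unbeta bs)

  unbeta-beta : ∀ p → unbeta (beta p) ≡ p
  unbeta-beta []       = refl
  unbeta-beta (r ∷ rs) = cong₂ _∷_
    (trans (cong (r + length rs ∸_) (length-beta rs)) (m+n∸n≡m r (length rs))) (unbeta-beta rs)

  -- Ensures that the truncated subtraction in `unbeta` loses nothing.
  length≤head : ∀ {b bs} → Decreasing (b ∷ bs) → length bs ≤ b
  length≤head {bs = []}     _                        = z≤n
  length≤head {bs = b ∷ bs} ((b>b′ ∷ _) ∷ decreasing) = ≤-<-trans (length≤head decreasing) b>b′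

  beta-unbeta : ∀ {bs} → Decreasing bs → beta (unbeta bs) ≡ bs
  beta-unbeta []                                = refl
  beta-unbeta {b ∷ bs} h@(_ ∷ decreasing) = cong₂ _∷_
    (trans (cong (b ∸ length bs +_) (length-unbeta bs)) (m∸n+n≡m (length≤head h))) (beta-unbeta decreasing)

  suc-C-2 : ∀ n → suc n C 2 ≡ n + n C 2
  suc-C-2 n = trans (sym (nCk+nC[k+1]≡[n+1]C[k+1] n 1)) (cong (_+ n C 2) (nC1≡n n))

  sum-beta : ∀ p → sum (beta p) ≡ sum p + length p C 2
  sum-beta []       = refl
  sum-beta (r ∷ rs) = begin
    r + length rs + sum (beta rs)                 ≡⟨ cong (r + length rs +_) (sum-beta rs) ⟩
    r + length rs + (sum rs + length rs C 2)      ≡⟨ solve 4 (λ r l s c → r :+ l :+ (s :+ c) := r :+ s :+ (l :+ c)) refl r (length rs) (sum rs) (length rs C 2) ⟩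
    r + sum rs + (length rs + length rs C 2)      ≡⟨ cong (r + sum rs +_) (suc-C-2 (length rs)) ⟨
    r + sum rs + suc (length rs) C 2              ∎
    where
    open ≡-Reasoning
    open ℕ-Solver

  -- One unit of the gap comes from r > r′, a second from the number of remaining parts dropping by
  -- one.
  beta-gaps : ∀ {r rs} → All (r >_) rs → Decreasing rs → All (λ b → suc b < r + length rs) (beta rs)
  beta-gaps []          []                      = []
  beta-gaps {r} {r′ ∷ rs} (r>r′ ∷ r>rs) (r′>rs ∷ decreasing) =
    subst (suc (r′ + length rs) <_) (sym (+-suc r (length rs))) (s≤s (+-monoˡ-< (length rs) r>r′))
    ∷ All.map (λ b< → <-≤-trans b< (+-monoʳ-≤ r (n≤1+n (length rs)))) (beta-gaps r>rs decreasing)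

  beta-below : ∀ {r rs x} → Decreasing (r ∷ rs) → x ∈ beta rs → suc x < r + length rs
  beta-below (r>rs ∷ decreasing) x∈ = All.lookup (beta-gaps r>rs decreasing) x∈

  beta-decreasing : ∀ {p} → Decreasing p → Decreasing (beta p)
  beta-decreasing []                      = []
  beta-decreasing (r>rs ∷ decreasing) =
    All.map (<-trans (n<1+n _)) (beta-gaps r>rs decreasing) ∷ beta-decreasing decreasing

  beta-no-consecutive : ∀ {p x} → Decreasing p → x ∈ beta p → suc x ∉ beta p
  beta-no-consecutive {_ ∷ _} h (here refl) (here eq) = 1+n≢n eq
  beta-no-consecutive {_ ∷ _} h (here refl) (there m) = <-irrefl refl (<-trans (<-trans (n<1+n _) (n<1+n _)) (beta-below h m))
  beta-no-consecutive {_ ∷ _} h (there m) (here eq) = <-irrefl eq (beta-below h m)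
  beta-no-consecutive {_ ∷ _} (_ ∷ decreasing) (there m) (there m′) = beta-no-consecutive decreasing m m′

  beta-positive : ∀ {p} → All (0 <_) p → 0 ∉ beta p
  beta-positive {r ∷ rs} (0<r ∷ _) (here eq) = <-irrefl eq (≤-trans 0<r (m≤m+n r (length rs)))
  beta-positive {_ ∷ _} (_ ∷ 0<rs) (there m)         = beta-positive 0<rs m

  -- Neighbouring elements differ by at least 2, and one unit of that is due to the length, so the
  -- parts still differ by at least 1. Omitting 0 matters for the smallest part; the others are
  -- positive by being larger.
  distinctParts : ∀ {p} → Decreasing (beta p) → (∀ {x} → x ∈ beta p → suc x ∉ beta p) → 0 ∉ beta p → DistinctParts p
  distinctParts {[]} _ _ _ = [] , []
  distinctParts {r ∷ []} _ _ 0∉ = [-] , n≢0⇒n>0 (λ { refl → 0∉ (here refl) }) ∷ []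
  distinctParts {r ∷ r′ ∷ rs} ((b>b′ ∷ _) ∷ decreasing) isolated 0∉
    with distinctParts {r′ ∷ rs} decreasing (λ m m′ → isolated (there m) (there m′)) (0∉ ∘ there)
  ... | linked , positive = r>r′ ∷ linked , ≤-<-trans z≤n r>r′ ∷ positive
    where
    r>r′ : r > r′
    r>r′ = +-cancelʳ-< (length rs) r′ r (≤-pred (subst (suc (r′ + length rs) <_) (+-suc r (length rs))
      (≤∧≢⇒< b>b′ (λ eq → isolated (there (here refl)) (here eq)))))

  Decreasing-ext : ∀ {xs ys} → Decreasing xs → Decreasing ys →
                   (∀ {z} → z ∈ xs → z ∈ ys) → (∀ {z} → z ∈ ys → z ∈ xs) → xs ≡ ys
  Decreasing-ext {[]}     {[]}     _ _ _ _ = refl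
  Decreasing-ext {[]}     {y ∷ ys} _ _ _ ⊇ = contradiction (⊇ (here refl)) λ ()
  Decreasing-ext {x ∷ xs} {[]}     _ _ ⊆ _ = contradiction (⊆ (here refl)) λ ()
  Decreasing-ext {x ∷ xs} {y ∷ ys} (x> ∷ dx) (y> ∷ dy) ⊆ ⊇ =
    cong₂ _∷_ x≡y (Decreasing-ext dx dy
      (λ m → tail (⊆ (there m)) λ { refl → <-irrefl (sym x≡y) (All.lookup x> m) })
      (λ m → tail (⊇ (there m)) λ { refl → <-irrefl x≡y (All.lookup y> m) }))
    where
    bound : ∀ {z w ws} → All (w >_) ws → z ∈ w ∷ ws → z ≤ w
    bound _  (here refl) = ≤-refl
    bound w> (there m)   = <⇒≤ (All.lookup w> m)
    x≡y : x ≡ y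
    x≡y = ≤-antisym (bound y> (⊆ (here refl))) (bound x> (⊇ (here refl)))
    tail : ∀ {z w} {ws : List ℕ} → z ∈ w ∷ ws → z ≢ w → z ∈ ws
    tail (here eq) z≢w = contradiction eq z≢w
    tail (there m) _   = m

-- Hook lengths as differences in the beta-set; cores as closed beta-sets.

module Hooks where
  open BetaSets

  colLen-accept : ∀ {j r} rs → j ≤ r → colLen j (r ∷ rs) ≡ suc (colLen j rs)
  colLen-accept {j} rs j≤r = cong length (filter-accept (j ≤?_) j≤r)

  colLen-reject : ∀ {j r} rs → ¬ j ≤ r → colLen j (r ∷ rs) ≡ colLen j rs
  colLen-reject {j} rs j≰r = cong length (filter-reject (j ≤?_) j≰r)

  -- The leg is counted in the rows below only, and columns start at 0, so the recursion can drop
  -- the upper rows.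
  rowHook : ℕ → List ℕ → ℕ → ℕ
  rowHook r rs j = suc ((r ∸ suc j) + colLen (suc j) rs)

  Rows : (ℕ → Set) → List ℕ → Set
  Rows P []       = ⊤
  Rows P (r ∷ rs) = (∀ {j} → j < r → P (rowHook r rs j)) × Rows P rs

  -- The k rows above the rows of the second argument contribute k boxes to each of their columns.
  Above : ℕ → List ℕ → List ℕ → Set
  Above k []       p = ⊤
  Above k (r ∷ rs) p = ∀ j → j ≤ r → colLen j p ≡ k + colLen j (r ∷ rs)

  Above-tail : ∀ {k r rs p} → Decreasing (r ∷ rs) → Above k (r ∷ rs) p → Above (suc k) rs p
  Above-tail {rs = []} _ _ = tt
  Above-tail {k} {r} {r′ ∷ rs} {p} ((r>r′ ∷ _) ∷ _) above j j≤r′ = begin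
    colLen j p                          ≡⟨ above j j≤r ⟩
    k + colLen j (r ∷ r′ ∷ rs)           ≡⟨ cong (k +_) (colLen-accept (r′ ∷ rs) j≤r) ⟩
    k + suc (colLen j (r′ ∷ rs))         ≡⟨ +-suc k _ ⟩
    suc k + colLen j (r′ ∷ rs)           ∎
    where
    open ≡-Reasoning
    j≤r : j ≤ r
    j≤r = ≤-trans j≤r′ (<⇒≤ r>r′)

  hook≡rowHook : ∀ {k r rs p j} → Above k (r ∷ rs) p → j < r →
                 suc ((r ∸ suc j) + (colLen (suc j) p ∸ suc k)) ≡ rowHook r rs j
  hook≡rowHook {k} {r} {rs} {p} {j} above j<r = cong (λ c → suc ((r ∸ suc j) + c)) (begin
    colLen (suc j) p ∸ suc k                     ≡⟨ cong (_∸ suc k) (above (suc j) j<r) ⟩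
    (k + colLen (suc j) (r ∷ rs)) ∸ suc k         ≡⟨ cong (λ c → k + c ∸ suc k) (colLen-accept rs j<r) ⟩
    (k + suc (colLen (suc j) rs)) ∸ suc k         ≡⟨ cong (_∸ suc k) (+-suc k _) ⟩
    (suc k + colLen (suc j) rs) ∸ suc k           ≡⟨ m+n∸m≡n (suc k) _ ⟩
    colLen (suc j) rs                            ∎)
    where open ≡-Reasoning

  module _ {P : ℕ → Set} where

    hooks⇒rows : ∀ {k rs p} → Decreasing rs → Above k rs p → All P (hooksFrom (suc k) rs p) → Rows P rs
    hooks⇒rows [] _ _ = tt
    hooks⇒rows {k} {r ∷ rs} {p} h@(_ ∷ decreasing) above all
      with Allₚ.++⁻ (map (λ j → suc ((r ∸ j) + (colLen j p ∸ suc k))) (map suc (upTo r))) all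
    ... | row , rest =
      (λ j<r → subst P (hook≡rowHook {rs = rs} {p} above j<r)
        (Allₚ.applyUpTo⁻ (λ j → j) r (Allₚ.map⁻ (Allₚ.map⁻ row)) j<r))
      , hooks⇒rows decreasing (Above-tail {p = p} h above) rest

    rows⇒hooks : ∀ {k rs p} → Decreasing rs → Above k rs p → Rows P rs → All P (hooksFrom (suc k) rs p)
    rows⇒hooks [] _ _ = []
    rows⇒hooks {k} {r ∷ rs} {p} h@(_ ∷ decreasing) above (row , rest) = Allₚ.++⁺
      (Allₚ.map⁺ (Allₚ.map⁺ (Allₚ.applyUpTo⁺₁ (λ j → j) r
        (λ j<r → subst P (sym (hook≡rowHook {rs = rs} {p} above j<r)) (row j<r)))))
      (rows⇒hooks decreasing (Above-tail {p = p} h above) rest)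

  above-self : ∀ p → Above 0 p p
  above-self []      = tt
  above-self (_ ∷ _) = λ _ _ → refl

  -- The j-th number, counted from 0, that is not in beta rs.
  gap : ℕ → List ℕ → ℕ
  gap j []       = j
  gap j (r ∷ rs) with suc j ≤? r
  ... | yes _ = gap j rs
  ... | no  _ = suc (gap j rs)

  -- Each row either reaches column j and is counted by `colLen`, or falls short and pushes the gap
  -- up by one.
  gap-colLen : ∀ j rs → gap j rs + colLen (suc j) rs ≡ j + length rs
  gap-colLen j []       = refl
  gap-colLen j (r ∷ rs) with suc j ≤? r
  ... | yes j<r = begin
    gap j rs + colLen (suc j) (r ∷ rs)     ≡⟨ cong (gap j rs +_) (colLen-accept rs j<r) ⟩
    gap j rs + suc (colLen (suc j) rs)     ≡⟨ +-suc (gap j rs) _ ⟩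
    suc (gap j rs + colLen (suc j) rs)     ≡⟨ cong suc (gap-colLen j rs) ⟩
    suc (j + length rs)                    ≡⟨ +-suc j (length rs) ⟨
    j + suc (length rs)                    ∎
    where open ≡-Reasoning
  ... | no  j≮r = begin
    suc (gap j rs + colLen (suc j) (r ∷ rs)) ≡⟨ cong (λ c → suc (gap j rs + c)) (colLen-reject rs j≮r) ⟩
    suc (gap j rs + colLen (suc j) rs)     ≡⟨ cong suc (gap-colLen j rs) ⟩
    suc (j + length rs)                    ≡⟨ +-suc j (length rs) ⟨
    j + suc (length rs)                    ∎
    where open ≡-Reasoning

  gap≤ : ∀ j rs → gap j rs ≤ j + length rs
  gap≤ j rs = subst (gap j rs ≤_) (gap-colLen j rs) (m≤m+n (gap j rs) _)

  gap-large : ∀ {j rs} → All (_≤ j) rs → gap j rs ≡ j + length rs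
  gap-large [] = sym (+-identityʳ _)
  gap-large {j} {r ∷ rs} (r≤j ∷ rs≤j) with suc j ≤? r
  ... | yes j<r = contradiction j<r (≤⇒≯ r≤j)
  ... | no  _   = trans (cong suc (gap-large rs≤j)) (sym (+-suc j (length rs)))

  tail≤ : ∀ {j r rs} → All (r >_) rs → r ≤ j → All (_≤ j) rs
  tail≤ r>rs r≤j = All.map (λ r>s → ≤-trans (<⇒≤ r>s) r≤j) r>rs

  -- The link between hooks and beta-sets: the hook lengths of a row are its beta-number minus the
  -- missing numbers below it.
  rowHook+gap : ∀ {j r} rs → j < r → rowHook r rs j + gap j rs ≡ r + length rs
  rowHook+gap {j} {r} rs j<r = begin
    suc ((r ∸ suc j) + colLen (suc j) rs) + gap j rs
      ≡⟨ solve 3 (λ a c g → con 1 :+ (a :+ c) :+ g := con 1 :+ a :+ (g :+ c)) refl (r ∸ suc j) (colLen (suc j) rs) (gap j rs) ⟩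
    suc (r ∸ suc j) + (gap j rs + colLen (suc j) rs)
      ≡⟨ cong (suc (r ∸ suc j) +_) (gap-colLen j rs) ⟩
    suc (r ∸ suc j) + (j + length rs)
      ≡⟨ solve 3 (λ a j l → con 1 :+ a :+ (j :+ l) := a :+ (con 1 :+ j) :+ l) refl (r ∸ suc j) j (length rs) ⟩
    (r ∸ suc j + suc j) + length rs
      ≡⟨ cong (_+ length rs) (m∸n+n≡m j<r) ⟩
    r + length rs ∎
    where
    open ≡-Reasoning
    open ℕ-Solver

  gap∉beta : ∀ {rs} j → Decreasing rs → gap j rs ∉ beta rs
  gap∉beta {r ∷ rs} j h@(r>rs ∷ decreasing) m with suc j ≤? r
  gap∉beta {r ∷ rs} j h@(r>rs ∷ decreasing) (here eq) | yes j<r =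
    <-irrefl eq (≤-<-trans (gap≤ j rs) (+-monoˡ-< (length rs) j<r))
  gap∉beta {r ∷ rs} j h@(r>rs ∷ decreasing) (there m) | yes j<r = gap∉beta j decreasing m
  gap∉beta {r ∷ rs} j h@(r>rs ∷ decreasing) (here eq) | no j≮r =
    <-irrefl (sym eq) (s≤s (≤-trans (+-monoˡ-≤ (length rs) (≮⇒≥ j≮r)) (≤-reflexive (sym (gap-large (tail≤ r>rs (≮⇒≥ j≮r)))))))
  gap∉beta {r ∷ rs} j h@(r>rs ∷ decreasing) (there m) | no j≮r = <-irrefl refl (<-trans (n<1+n _)
    (<-≤-trans (beta-below h m) (≤-trans (+-monoˡ-≤ (length rs) (≮⇒≥ j≮r))
      (≤-trans (≤-reflexive (sym (gap-large (tail≤ r>rs (≮⇒≥ j≮r))))) (n≤1+n _)))))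

  -- Below the head, x is a gap of the tail which the long row r does not move. Above the head,
  -- every row falls short of the column and the gap is explicit.
  ∉beta⇒gap : ∀ {rs x} → Decreasing rs → x ∉ beta rs → ∃ λ j → gap j rs ≡ x
  ∉beta⇒gap {[]} {x} _ _ = x , refl
  ∉beta⇒gap {r ∷ rs} {x} (r>rs ∷ decreasing) x∉ with <-cmp x (r + length rs)
  ... | tri≈ _ eq _ = contradiction (here eq) x∉

  ... | tri< x< _ _ with ∉beta⇒gap decreasing (x∉ ∘ there)
  ...   | j , eq = j , below
    where
    below : gap j (r ∷ rs) ≡ x
    below with suc j ≤? r
    ... | yes _   = eq
    ... | no  j≮r = contradiction x< (≤⇒≯ (≤-trans (+-monoˡ-≤ (length rs) (≮⇒≥ j≮r))
                      (≤-reflexive (trans (sym (gap-large (tail≤ r>rs (≮⇒≥ j≮r)))) eq))))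
  ∉beta⇒gap {r ∷ rs} {x} (r>rs ∷ decreasing) x∉ | tri> _ _ x> = j , above
    where
    -- Solves 1 + (j + `length rs`) = x, the value of the gap once all rows are short.
    j = x ∸ suc (length rs)
    j+ : j + suc (length rs) ≡ x
    j+ = m∸n+n≡m (≤-trans (s≤s (m≤n+m (length rs) r)) x>)
    r≤j : r ≤ j
    r≤j = +-cancelʳ-≤ (suc (length rs)) r j (≤-trans (≤-reflexive (+-suc r (length rs))) (≤-trans x> (≤-reflexive (sym j+))))
    above : gap j (r ∷ rs) ≡ x
    above with suc j ≤? r
    ... | yes j<r = contradiction j<r (≤⇒≯ r≤j)
    ... | no  _   = trans (cong suc (gap-large (tail≤ r>rs r≤j))) (trans (sym (+-suc j (length rs))) j+)

  Closed : ℕ → List ℕ → Set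
  Closed t B = ∀ {x} → t + x ∈ B → x ∈ B

  -- If t + x is the head and x is missing, then x is the j-th gap of the tail. For j < r the hook
  -- in column j is t itself; for j ≥ r the gap is at least the head, contradicting 0 < t.
  rows⇒closed : ∀ {t p} → 0 < t → Decreasing p → Rows (λ h → ¬ t ∣ h) p → Closed t (beta p)
  rows⇒closed {p = _ ∷ _} 0<t (_ ∷ decreasing) (_ , rest) (there m) = there (rows⇒closed 0<t decreasing rest m)
  rows⇒closed {t} {r ∷ rs} 0<t (r>rs ∷ decreasing) (row , _) {x} (here eq) with x ∈? beta rs
  ... | yes x∈ = there x∈
  ... | no  x∉ with ∉beta⇒gap decreasing x∉
  ...   | j , refl with suc j ≤? r
  ...     | yes j<r = contradiction (subst (t ∣_) (sym hook≡t) ∣-refl) (row j<r)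
    where
    hook≡t : rowHook r rs j ≡ t
    hook≡t = +-cancelʳ-≡ (gap j rs) _ _ (trans (rowHook+gap rs j<r) (sym eq))
  ...     | no  j≮r = contradiction (subst (gap j rs <_) eq (+-monoˡ-< (gap j rs) 0<t))
    (≤⇒≯ (≤-trans (+-monoˡ-≤ (length rs) (≮⇒≥ j≮r)) (≤-reflexive (sym (gap-large (tail≤ r>rs (≮⇒≥ j≮r)))))))

  Closed-multiple : ∀ {t B} → Closed t B → ∀ c {x} → c * t + x ∈ B → x ∈ B
  Closed-multiple closed zero    m = m
  Closed-multiple {t} {B} closed (suc c) {x} m = Closed-multiple closed c
    (closed (subst (_∈ B) (+-assoc t (c * t) x) m))

  -- If a hook equals c t, the head is c t plus a gap, and closure applied c times puts that gap
  -- into the beta-set. It is not the head, as hooks are positive, and it is not in the tail, being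
  -- a gap.
  closed⇒rows : ∀ {t p} → Decreasing p → Closed t (beta p) → Rows (λ h → ¬ t ∣ h) p
  closed⇒rows [] _ = tt
  closed⇒rows {t} {r ∷ rs} h@(r>rs ∷ decreasing) closed = row , closed⇒rows decreasing closed-tail
    where
    closed-tail : Closed t (beta rs)
    closed-tail {x} m with closed (there m)
    ... | here refl = contradiction (beta-below h m) (≤⇒≯ (≤-trans (m≤n+m _ t) (n≤1+n _)))
    ... | there m′  = m′
    row : ∀ {j} → j < r → ¬ t ∣ rowHook r rs j
    row {j} j<r (divides c eq) with Closed-multiple closed c {gap j rs}
      (here (trans (cong (_+ gap j rs) (sym eq)) (rowHook+gap rs j<r)))
    ... | here gap≡head = m≢1+n+m (gap j rs) (trans gap≡head (sym (rowHook+gap rs j<r)))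
    ... | there m       = gap∉beta j decreasing m

  core⇒closed : ∀ {t p} → 0 < t → Decreasing p → IsCore t p → Closed t (beta p)
  core⇒closed {p = p} 0<t h core = rows⇒closed 0<t h (hooks⇒rows {p = p} h (above-self p) core)

  closed⇒core : ∀ {t p} → Decreasing p → Closed t (beta p) → IsCore t p
  closed⇒core {p = p} h closed = rows⇒hooks {p = p} h (above-self p) (closed⇒rows h closed)

-- The set encoded by a word: membership, injectivity, sum and cardinality.

module Abacus where
  open BetaSets
  open Words

  -- The entry at position i, counted from the end of the word.
  entry : List ℕ → ℕ → ℕ
  entry []      i = 0
  entry (a ∷ w) i with i ℕ.≟ length w
  ... | yes _ = a
  ... | no  _ = entry w i

  entry-head : ∀ a w {i} → i ≡ length w → entry (a ∷ w) i ≡ a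
  entry-head a w {i} eq with i ℕ.≟ length w
  ... | yes _   = refl
  ... | no  neq = contradiction eq neq

  entry-tail : ∀ a w {i} → i ≢ length w → entry (a ∷ w) i ≡ entry w i
  entry-tail a w {i} neq with i ℕ.≟ length w
  ... | yes eq = contradiction eq neq
  ... | no  _  = refl

  entry-beyond : ∀ w {i} → length w ≤ i → entry w i ≡ 0
  entry-beyond []      _   = refl
  entry-beyond (a ∷ w) l≤i = trans (entry-tail a w (>⇒≢ l≤i)) (entry-beyond w (<⇒≤ l≤i))

  entry>0⇒< : ∀ w {i} → 0 < entry w i → i < length w
  entry>0⇒< w {i} 0<e with length w ≤? i
  ... | yes l≤i = contradiction (entry-beyond w l≤i) (>⇒≢ 0<e)
  ... | no  l≰i = ≰⇒> l≰i

  entry-pred : ∀ w i → entry (map pred w) i ≡ pred (entry w i)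
  entry-pred []      i = refl
  entry-pred (a ∷ w) i with i ℕ.≟ length w
  ... | yes eq  = entry-head (pred a) (map pred w) (trans eq (sym (length-map pred w)))
  ... | no  neq = trans (entry-tail (pred a) (map pred w) (λ eq → neq (trans eq (length-map pred w)))) (entry-pred w i)

  entry-≤ : ∀ {h w} → All (_≤ h) w → ∀ i → entry w i ≤ h
  entry-≤ [] i = z≤n
  entry-≤ {w = a ∷ w} (a≤h ∷ w≤h) i with i ℕ.≟ length w
  ... | yes _ = a≤h
  ... | no  _ = entry-≤ w≤h i

  entry-ext : ∀ v w → length v ≡ length w → (∀ i → entry v i ≡ entry w i) → v ≡ w
  entry-ext []      []      _  _  = refl
  entry-ext (a ∷ v) (b ∷ w) eq eqs = cong₂ _∷_
    (trans (sym (entry-head a v refl)) (trans (eqs (length v)) (entry-head b w l)))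
    (entry-ext v w l tails)
    where
    l : length v ≡ length w
    l = cong pred eq
    tails : ∀ i → entry v i ≡ entry w i
    tails i with i ℕ.≟ length v
    ... | yes i≡ = trans (entry-beyond v (≤-reflexive (sym i≡))) (sym (entry-beyond w (≤-reflexive (sym (trans i≡ l)))))
    ... | no  i≢ = trans (sym (entry-tail a v i≢)) (trans (eqs i) (entry-tail b w (λ i≡ → i≢ (trans i≡ (sym l)))))

  support : List ℕ → List ℕ
  support []          = []
  support (zero ∷ w)  = support w
  support (suc _ ∷ w) = length w ∷ support w

  -- The set of all c n + i with c < a_i, one layer c at a time.
  betaOf : ℕ → ℕ → List ℕ → List ℕ
  betaOf n zero    w = []
  betaOf n (suc d) w = map (n +_) (betaOf n d (map pred w)) ++ support w

  support-< : ∀ w → All (_< length w) (support w)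
  support-< []          = []
  support-< (zero ∷ w)  = All.map m<n⇒m<1+n (support-< w)
  support-< (suc _ ∷ w) = n<1+n _ ∷ All.map m<n⇒m<1+n (support-< w)

  support-decreasing : ∀ w → Decreasing (support w)
  support-decreasing []          = []
  support-decreasing (zero ∷ w)  = support-decreasing w
  support-decreasing (suc _ ∷ w) = support-< w ∷ support-decreasing w

  betaOf-decreasing : ∀ {n} d {w} → length w ≡ n → Decreasing (betaOf n d w)
  betaOf-decreasing zero    _ = []
  betaOf-decreasing {n} (suc d) {w} refl = AllPairsₚ.++⁺
    (AllPairsₚ.map⁺ (AllPairs.map (+-monoʳ-< n) (betaOf-decreasing d (length-map pred w))))
    (support-decreasing w)
    (Allₚ.map⁺ (All.universal (λ x → All.map (λ s< → <-≤-trans s< (m≤m+n n x)) (support-< w)) (betaOf n d (map pred w))))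

  ∈support⇒entry : ∀ w {i} → i ∈ support w → 0 < entry w i
  ∈support⇒entry (suc a ∷ w) (here refl) = subst (0 <_) (sym (entry-head (suc a) w refl)) z<s
  ∈support⇒entry (zero ∷ w)  m = subst (0 <_) (sym (entry-tail 0 w (<⇒≢ (All.lookup (support-< w) m)))) (∈support⇒entry w m)
  ∈support⇒entry (suc a ∷ w) (there m) =
    subst (0 <_) (sym (entry-tail (suc a) w (<⇒≢ (All.lookup (support-< w) m)))) (∈support⇒entry w m)

  entry⇒∈support : ∀ w {i} → 0 < entry w i → i ∈ support w
  entry⇒∈support (a ∷ w) {i} 0<e with i ℕ.≟ length w
  entry⇒∈support (suc a ∷ w) 0<e | yes eq = here eq
  entry⇒∈support (zero ∷ w)  0<e | no  _  = entry⇒∈support w 0<e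
  entry⇒∈support (suc a ∷ w) 0<e | no  _  = there (entry⇒∈support w 0<e)

  ∈betaOf⇒entry : ∀ {n} d w {x} → length w ≡ n → x ∈ betaOf n d w →
                  ∃ λ c → ∃ λ i → x ≡ c * n + i × i < n × c < d × c < entry w i
  ∈betaOf⇒entry {n} (suc d) w {x} refl m with ∈-++⁻ (map (n +_) (betaOf n d (map pred w))) m
  ... | inj₂ m′ = 0 , x , refl , All.lookup (support-< w) m′ , z<s , ∈support⇒entry w m′
  ... | inj₁ m′ with ∈-map⁻ (n +_) m′
  ...   | y , y∈ , refl with ∈betaOf⇒entry d (map pred w) (length-map pred w) y∈
  ...     | c , i , refl , i<n , c<d , c<e = suc c , i , sym (+-assoc n (c * n) i) , i<n , s≤s c<d ,
            <pred⇒suc< (subst (c <_) (entry-pred w i) c<e)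
    where
    <pred⇒suc< : ∀ {a b} → a < pred b → suc a < b
    <pred⇒suc< {b = suc b} a<b = s≤s a<b

  entry⇒∈betaOf : ∀ {n} d w c i → c < d → c < entry w i → c * n + i ∈ betaOf n d w
  entry⇒∈betaOf {n} (suc d) w zero    i _ 0<e = ∈-++⁺ʳ (map (n +_) (betaOf n d (map pred w))) (entry⇒∈support w 0<e)
  entry⇒∈betaOf {n} (suc d) w (suc c) i (s≤s c<d) c<e = ∈-++⁺ˡ (subst (_∈ map (n +_) (betaOf n d (map pred w)))
    (sym (+-assoc n (c * n) i))
    (∈-map⁺ (n +_) (entry⇒∈betaOf d (map pred w) c i c<d (subst (c <_) (sym (entry-pred w i)) (suc[m]≤n⇒m≤pred[n] c<e)))))

  position-unique : ∀ {n} c c′ {i i′} → i < n → i′ < n → c * n + i ≡ c′ * n + i′ → c ≡ c′ × i ≡ i′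
  position-unique zero    zero     _   _    eq = refl , eq
  position-unique {n} zero (suc c′) i<n _ refl = contradiction i<n (≤⇒≯ (≤-trans (m≤m+n n (c′ * n)) (m≤m+n (n + c′ * n) _)))
  position-unique {n} (suc c) zero _ i′<n refl = contradiction i′<n (≤⇒≯ (≤-trans (m≤m+n n (c * n)) (m≤m+n (n + c * n) _)))
  position-unique {n} (suc c) (suc c′) {i} {i′} i<n i′<n eq
    with position-unique c c′ i<n i′<n (+-cancelˡ-≡ n _ _ (trans (sym (+-assoc n (c * n) i)) (trans eq (+-assoc n (c′ * n) i′))))
  ... | c≡c′ , i≡i′ = cong suc c≡c′ , i≡i′

  position-< : ∀ {n} c {d i} → c < d → i < n → c * n + i < d * n
  position-< {n} c {d} {i} c<d i<n = <-≤-trans (+-monoʳ-< (c * n) i<n)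
    (≤-trans (≤-reflexive (+-comm (c * n) n)) (*-monoˡ-≤ n c<d))

  ∈betaOf⇒< : ∀ {n} d w c i → length w ≡ n → i < n → c * n + i ∈ betaOf n d w → c < entry w i
  ∈betaOf⇒< d w c i l i<n m with ∈betaOf⇒entry d w l m
  ... | c′ , i′ , eq , i′<n , _ , c′<e with position-unique c c′ i<n i′<n eq
  ...   | refl , refl = c′<e

  -- If a_i is smaller for w than for v, the element a_i n + i with the smaller value lies in the
  -- set of v only. The bound d matters because `betaOf` keeps just d layers.
  betaOf-injective : ∀ {n} d {v w} → length v ≡ n → length w ≡ n → All (_≤ d) v → All (_≤ d) w →
                     betaOf n d v ≡ betaOf n d w → v ≡ w
  betaOf-injective {n} d {v} {w} lv lw v≤d w≤d eq =
    entry-ext v w (trans lv (sym lw)) λ i → ≤-antisym (below v w lv lw v≤d eq i) (below w v lw lv w≤d (sym eq) i)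
    where
    below : ∀ v w → length v ≡ n → length w ≡ n → All (_≤ d) v → betaOf n d v ≡ betaOf n d w → ∀ i → entry v i ≤ entry w i
    below v w lv lw v≤d eq i with entry v i ≤? entry w i
    ... | yes v≤w = v≤w
    ... | no  v≰w = contradiction
      (∈betaOf⇒< d w (entry w i) i lw (subst (i <_) lv (entry>0⇒< v (≤-<-trans z≤n w<v)))
        (subst (entry w i * n + i ∈_) eq (entry⇒∈betaOf d v (entry w i) i (<-≤-trans w<v (entry-≤ v≤d i)) w<v)))
      (n≮n _)
      where w<v = ≰⇒> v≰w

  -- This and the next two lemmas record the effect of peeling off the bottom layer, that is, of
  -- lowering every nonzero entry by one.
  sum-support : ∀ w → momentOf w ≡ momentOf (map pred w) + sum (support w)
  sum-support []          = refl
  sum-support (zero ∷ w)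
    rewrite length-map pred w | *-zeroʳ (length w) = sum-support w
  sum-support (suc a ∷ w)
    rewrite length-map pred w | *-suc (length w) a | sum-support w =
    solve 4 (λ l p m s → l :+ p :+ (m :+ s) := p :+ m :+ (l :+ s)) refl
      (length w) (length w * a) (momentOf (map pred w)) (sum (support w))
    where open ℕ-Solver

  length-support : ∀ w → sum w ≡ sum (map pred w) + length (support w)
  length-support []          = refl
  length-support (zero ∷ w)  = length-support w
  length-support (suc a ∷ w) rewrite length-support w =
    solve 3 (λ a s l → con 1 :+ a :+ (s :+ l) := a :+ s :+ (con 1 :+ l)) refl a (sum (map pred w)) (length (support w))
    where open ℕ-Solver

  pairs-pred : ∀ w → pairsOf w ≡ pairsOf (map pred w) + sum (map pred w)
  pairs-pred []          = refl
  pairs-pred (zero ∷ w)  = pairs-pred w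
  pairs-pred (suc a ∷ w) rewrite suc-C-2 a | pairs-pred w =
    solve 4 (λ a c p s → a :+ c :+ (p :+ s) := c :+ p :+ (a :+ s)) refl
      a (a C 2) (pairsOf (map pred w)) (sum (map pred w))
    where open ℕ-Solver

  sum-map-+ : ∀ n xs → sum (map (n +_) xs) ≡ n * length xs + sum xs
  sum-map-+ n []       = sym (trans (+-identityʳ (n * 0)) (*-zeroʳ n))
  sum-map-+ n (x ∷ xs) rewrite sum-map-+ n xs | *-suc n (length xs) =
    solve 4 (λ n x p s → n :+ x :+ (p :+ s) := n :+ p :+ (x :+ s)) refl n x (n * length xs) (sum xs)
    where open ℕ-Solver

  zeros : ∀ {w} → All (_≤ 0) w → momentOf w ≡ 0 × pairsOf w ≡ 0 × sum w ≡ 0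
  zeros [] = refl , refl , refl
  zeros {_ ∷ w} (z≤n ∷ w≤0) with zeros w≤0
  ... | m , p , s = trans (cong (_+ momentOf w) (*-zeroʳ (length w))) m , p , s

  -- Class i contributes i a_i + n (0 + 1 + ⋯ + (a_i - 1)). By layers: moving the upper ones up
  -- costs n per element, and the number of these elements is what `pairs-pred` adds to the pairs.
  betaOf-sums : ∀ n d {w} → All (_≤ d) w →
                sum (betaOf n d w) ≡ momentOf w + n * pairsOf w × length (betaOf n d w) ≡ sum w
  betaOf-sums n zero w≤0 with zeros w≤0
  ... | m , p , s = sym (trans (cong₂ (λ x y → x + n * y) m p) (*-zeroʳ n)) , sym s
  betaOf-sums n (suc d) {w} w≤d with betaOf-sums n d {map pred w} (Allₚ.map⁺ (All.map pred-mono-≤ w≤d))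
  ... | total , count =
    (begin
      sum (map (n +_) B ++ support w)
        ≡⟨ sum-++ (map (n +_) B) (support w) ⟩
      sum (map (n +_) B) + sum (support w)
        ≡⟨ cong (_+ sum (support w)) (sum-map-+ n B) ⟩
      n * length B + sum B + sum (support w)
        ≡⟨ cong₂ (λ x y → n * x + y + sum (support w)) count total ⟩
      n * sum v + (momentOf v + n * pairsOf v) + sum (support w)
        ≡⟨ solve 5 (λ n s m p t → n :* s :+ (m :+ n :* p) :+ t := m :+ t :+ n :* (p :+ s)) refl
             n (sum v) (momentOf v) (pairsOf v) (sum (support w)) ⟩
      momentOf v + sum (support w) + n * (pairsOf v + sum v)
        ≡⟨ cong₂ (λ x y → x + n * y) (sum-support w) (pairs-pred w) ⟨
      momentOf w + n * pairsOf w ∎)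
    , (begin
      length (map (n +_) B ++ support w)      ≡⟨ length-++ (map (n +_) B) ⟩
      length (map (n +_) B) + length (support w) ≡⟨ cong (_+ length (support w)) (trans (length-map (n +_) B) count) ⟩
      sum v + length (support w)              ≡⟨ length-support w ⟨
      sum w                                   ∎)
    where
    open ≡-Reasoning
    open ℕ-Solver
    v = map pred w
    B = betaOf n d v

-- Admissible words and their correspondence with cores.

module Classification where
  open BetaSets
  open Hooks
  open Words
  open Abacus

  record Admissible (d n : ℕ) (w : List ℕ) : Set where
    constructor admissible
    field
      length≡  : length w ≡ n
      bounded  : All (_≤ d) w
      lowest   : entry w 0 ≡ 0
      isolated : ∀ i → entry w i ≡ 0 ⊎ entry w (suc i) ≡ 0

  open Admissible

  admissible-zero : ∀ {d n w} → Admissible d n w → Admissible d (suc n) (0 ∷ w)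
  admissible-zero {w = w} (admissible l b z s) = admissible (cong suc l) (z≤n ∷ b) lowest′ isolated′
    where
    lowest′ : entry (0 ∷ w) 0 ≡ 0
    lowest′ with 0 ℕ.≟ length w
    ... | yes _ = refl
    ... | no  _ = z
    isolated′ : ∀ i → entry (0 ∷ w) i ≡ 0 ⊎ entry (0 ∷ w) (suc i) ≡ 0
    isolated′ i with i ℕ.≟ length w | suc i ℕ.≟ length w
    ... | yes _ | _     = inj₁ refl
    ... | no  _ | yes _ = inj₂ refl
    ... | no  _ | no  _ = s i

  admissible-entry : ∀ {d n w a} → a ≤ d → Admissible d n w → Admissible d (suc (suc n)) (a ∷ 0 ∷ w)
  admissible-entry {w = w} {a} a≤d adm with admissible-zero adm
  ... | admissible l b z s = admissible (cong suc l) (a≤d ∷ b) z isolated′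
    where
    isolated′ : ∀ i → entry (a ∷ 0 ∷ w) i ≡ 0 ⊎ entry (a ∷ 0 ∷ w) (suc i) ≡ 0
    isolated′ i with i ℕ.≟ suc (length w) | suc i ℕ.≟ suc (length w)
    ... | yes refl | yes eq  = contradiction eq 1+n≢n
    ... | yes refl | no  _   = inj₂ (entry-beyond (0 ∷ w) (n≤1+n _))
    ... | no  _    | yes eq  = inj₁ (entry-head 0 w (cong pred eq))
    ... | no  _    | no  _   = s i

  ∈extend⁻ : ∀ h {W v} → v ∈ extend h W → ∃ λ a → ∃ λ w → a < h × w ∈ W × v ≡ suc a ∷ 0 ∷ w
  ∈extend⁻ (suc h) {W} m with ∈-++⁻ (map (λ w → suc h ∷ 0 ∷ w) W) m
  ... | inj₁ m′ with ∈-map⁻ (λ w → suc h ∷ 0 ∷ w) m′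
  ...   | w , w∈ , eq = h , w , n<1+n h , w∈ , eq
  ∈extend⁻ (suc h) {W} m | inj₂ m′ with ∈extend⁻ h m′
  ...   | a , w , a<h , w∈ , eq = a , w , m<n⇒m<1+n a<h , w∈ , eq

  ∈extend⁺ : ∀ h {W a w} → a < h → w ∈ W → (suc a ∷ 0 ∷ w) ∈ extend h W
  ∈extend⁺ (suc h) {W} {a} a<1+h w∈ with a ℕ.≟ h
  ... | yes refl = ∈-++⁺ˡ (∈-map⁺ (λ w → suc h ∷ 0 ∷ w) w∈)
  ... | no  a≢h  = ∈-++⁺ʳ (map (λ w → suc h ∷ 0 ∷ w) W) (∈extend⁺ h (≤∧≢⇒< (≤-pred a<1+h) a≢h) w∈)

  words-admissible : ∀ d n {w} → w ∈ words d (suc n) → Admissible d n w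
  headBounded-admissible : ∀ {h} d j {w} → h ≤ d → w ∈ headBounded h d j → Admissible d (suc j) w × entry w j ≤ h
  words-admissible d zero (here refl) = admissible refl [] refl (λ _ → inj₁ refl)
  words-admissible d (suc j) m        = proj₁ (headBounded-admissible d j ≤-refl m)
  headBounded-admissible {h} d j h≤d m with ∈-++⁻ (map (0 ∷_) (words d (suc j))) m
  ... | inj₁ m′ with ∈-map⁻ (0 ∷_) m′
  ...   | w , w∈ , refl with words-admissible d j w∈
  ...     | adm = admissible-zero adm , subst (_≤ h) (sym (entry-head 0 w (sym (length≡ adm)))) z≤n
  headBounded-admissible {h} d (suc j) h≤d m | inj₂ m′ with ∈extend⁻ h m′
  ...   | a , w , a<h , w∈ , refl with words-admissible d j w∈
  ...     | adm = admissible-entry (≤-trans a<h h≤d) adm ,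
                  subst (_≤ h) (sym (entry-head (suc a) (0 ∷ w) (cong suc (sym (length≡ adm))))) a<h
  -- Since `words d 0` is empty, a word of length 1 cannot begin with a nonzero entry; this is how
  -- a₀ = 0 is built in.
  headBounded-admissible {h} d zero h≤d m | inj₂ m′ with ∈extend⁻ h m′
  ...   | _ , _ , _ , () , _

  wordOf : (ℕ → ℕ) → ℕ → List ℕ
  wordOf a zero    = []
  wordOf a (suc n) = a n ∷ wordOf a n

  length-wordOf : ∀ a n → length (wordOf a n) ≡ n
  length-wordOf a zero    = refl
  length-wordOf a (suc n) = cong suc (length-wordOf a n)

  entry-wordOf : ∀ a n {i} → i < n → entry (wordOf a n) i ≡ a i
  entry-wordOf a (suc n) {i} i<1+n with i ℕ.≟ n
  ... | yes refl = entry-head (a i) (wordOf a i) (sym (length-wordOf a i))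
  ... | no  i≢n  = trans (entry-tail (a n) (wordOf a n) (λ eq → i≢n (trans eq (length-wordOf a n))))
                         (entry-wordOf a n (≤∧≢⇒< (≤-pred i<1+n) i≢n))

  module _ {d : ℕ} (a : ℕ → ℕ) (a≤d : ∀ i → a i ≤ d) (a₀ : a 0 ≡ 0) (isolated : ∀ i → a i ≡ 0 ⊎ a (suc i) ≡ 0) where

    private
      first : ∀ h → wordOf a 1 ∈ headBounded h d 0
      first h = subst (λ x → (x ∷ []) ∈ headBounded h d 0) (sym a₀) (here refl)

      next : ∀ {h} j → a (suc j) ≤ h → wordOf a (suc j) ∈ words d (suc (suc j)) → wordOf a j ∈ words d (suc j) →
             wordOf a (suc (suc j)) ∈ headBounded h d (suc j)
      next {h} j a≤h m m′ with a (suc j) in eq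
      ... | zero = ∈-++⁺ˡ (∈-map⁺ (0 ∷_) m)
      ... | suc b with isolated j
      ...   | inj₂ a≡0 = contradiction (trans (sym eq) a≡0) λ ()
      ...   | inj₁ a≡0 = subst (λ x → (suc b ∷ x ∷ wordOf a j) ∈ headBounded h d (suc j)) (sym a≡0)
                           (∈-++⁺ʳ (map (0 ∷_) (words d (suc (suc j)))) (∈extend⁺ h a≤h m′))

    wordOf∈words : ∀ n → wordOf a n ∈ words d (suc n)
    wordOf∈words zero          = here refl
    wordOf∈words (suc zero)    = first d
    wordOf∈words (suc (suc j)) = next j (a≤d (suc j)) (wordOf∈words (suc j)) (wordOf∈words j)

    wordOf∈headBounded : ∀ {h} j → a j ≤ h → wordOf a (suc j) ∈ headBounded h d j
    wordOf∈headBounded {h} zero    _   = first h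
    wordOf∈headBounded     (suc j) a≤h = next j a≤h (wordOf∈words (suc j)) (wordOf∈words j)

  -- For a downward closed predicate this counts the c < d that satisfy it; it reads off a_i from a
  -- beta-set.
  firstFailure : ∀ {P : ℕ → Set} → Decidable P → ℕ → ℕ
  firstFailure P? zero    = 0
  firstFailure P? (suc d) with P? 0
  ... | yes _ = suc (firstFailure (P? ∘ suc) d)
  ... | no  _ = 0

  firstFailure≤ : ∀ {P : ℕ → Set} (P? : Decidable P) d → firstFailure P? d ≤ d
  firstFailure≤ P? zero    = z≤n
  firstFailure≤ P? (suc d) with P? 0
  ... | yes _ = s≤s (firstFailure≤ (P? ∘ suc) d)
  ... | no  _ = z≤n

  <firstFailure⇒ : ∀ {P : ℕ → Set} (P? : Decidable P) d {c} → c < firstFailure P? d → P c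
  <firstFailure⇒ P? (suc d) {c} c< with P? 0
  <firstFailure⇒ P? (suc d) {zero}  c<        | yes p = p
  <firstFailure⇒ P? (suc d) {suc c} (s≤s c<)  | yes p = <firstFailure⇒ (P? ∘ suc) d c<

  ⇒<firstFailure : ∀ {P : ℕ → Set} (P? : Decidable P) d → (∀ {c} → P (suc c) → P c) →
                   ∀ {c} → c < d → P c → c < firstFailure P? d
  ⇒<firstFailure {P} P? (suc d) down {c} c<d pc with P? 0
  ... | no ¬p = contradiction (toZero c pc) ¬p
    where
    toZero : ∀ c → P c → P 0
    toZero zero    p = p
    toZero (suc c) p = toZero c (down p)
  ⇒<firstFailure P? (suc d) down {zero}  c<d       pc | yes _ = z<s
  ⇒<firstFailure P? (suc d) down {suc c} (s≤s c<d) pc | yes _ = s≤s (⇒<firstFailure (P? ∘ suc) d down c<d pc)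

  partitionOf : ℕ → ℕ → List ℕ → List ℕ
  partitionOf n d w = unbeta (betaOf n d w)

  beta-partitionOf : ∀ {n} d {w} → length w ≡ n → beta (partitionOf n d w) ≡ betaOf n d w
  beta-partitionOf d l = beta-unbeta (betaOf-decreasing d l)

  size-partitionOf : ∀ {d n w} → Admissible d n w →
                     momentOf w + n * pairsOf w ≡ size (partitionOf n d w) + sum w C 2
  size-partitionOf {d} {n} {w} adm with betaOf-sums n d (bounded adm)
  ... | total , count = begin
    momentOf w + n * pairsOf w           ≡⟨ total ⟨
    sum (betaOf n d w)                   ≡⟨ cong sum (beta-partitionOf d (length≡ adm)) ⟨
    sum (beta p)                         ≡⟨ sum-beta p ⟩
    size p + length p C 2                ≡⟨ cong (λ l → size p + l C 2) (trans (length-unbeta (betaOf n d w)) count) ⟩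
    size p + sum w C 2                   ∎
    where
    open ≡-Reasoning
    p = partitionOf n d w

  -- Injectivity is asked for on members only: `partitionOf` separates words of the right length
  -- with entries at most d.
  map-unique : ∀ {A B : Set} {f : A → B} xs → (∀ {x y} → x ∈ xs → y ∈ xs → f x ≡ f y → x ≡ y) → Unique xs → Unique (map f xs)
  map-unique []       _   []            = []
  map-unique (x ∷ xs) inj (x∉ ∷ unique) =
    Allₚ.map⁺ (All.tabulate λ y∈ eq → All.lookup x∉ y∈ (inj (here refl) (there y∈) eq))
    ∷ map-unique xs (λ y∈ z∈ → inj (there y∈) (there z∈)) unique

  extend-unique : ∀ h {W} → Unique W → Unique (extend h W)
  extend-unique zero    _ = []
  extend-unique (suc h) {W} unique = Uniqueₚ.++⁺
    (Uniqueₚ.map⁺ (λ eq → ∷-injectiveʳ (∷-injectiveʳ eq)) unique) (extend-unique h unique) disjoint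
    where
    disjoint : ∀ {v} → ¬ (v ∈ map (λ w → suc h ∷ 0 ∷ w) W × v ∈ extend h W)
    disjoint (m , m′) with ∈-map⁻ (λ w → suc h ∷ 0 ∷ w) m | ∈extend⁻ h m′
    ... | _ , _ , refl | a , _ , a<h , _ , eq = <-irrefl (sym (suc-injective (∷-injectiveˡ eq))) a<h

  headBounded-unique′ : ∀ h d j → Unique (words d (suc j)) → Unique (words d j) → Unique (headBounded h d j)
  headBounded-unique′ h d j unique₁ unique₀ =
    Uniqueₚ.++⁺ (Uniqueₚ.map⁺ ∷-injectiveʳ unique₁) (extend-unique h unique₀) disjoint
    where
    disjoint : ∀ {v} → ¬ (v ∈ map (0 ∷_) (words d (suc j)) × v ∈ extend h (words d j))
    disjoint (m , m′) with ∈-map⁻ (0 ∷_) m | ∈extend⁻ h m′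
    ... | _ , _ , refl | _ , _ , _ , _ , ()

  words-unique : ∀ d j → Unique (words d j)
  words-unique d zero          = []
  words-unique d (suc zero)    = [] ∷ []
  words-unique d (suc (suc j)) = headBounded-unique′ d d j (words-unique d (suc j)) (words-unique d j)

  headBounded-unique : ∀ h d j → Unique (headBounded h d j)
  headBounded-unique h d j = headBounded-unique′ h d j (words-unique d (suc j)) (words-unique d j)

  -- The modulus t is d n + 1 with h = d, or d n − 1 with h = d − 1.
  module Cores (d j t h : ℕ) (0<d : 0 < d) (h≤d : h ≤ d) (0<t : 0 < t) where
    n = suc j

    allWords : List (List ℕ)
    allWords = headBounded h d j

    cores : List (List ℕ)
    cores = map (partitionOf n d) allWords

    module _ {w} (w∈ : w ∈ allWords) where
      private
        adm = proj₁ (headBounded-admissible d j h≤d w∈)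
        B   = betaOf n d w
        p   = partitionOf n d w

      core-length : length w ≡ n
      core-length = length≡ adm

      core-bounded : All (_≤ d) w
      core-bounded = bounded adm

      core-head : entry w j ≤ h
      core-head = proj₂ (headBounded-admissible d j h≤d w∈)

      core-< : ∀ {x} → x ∈ B → x < d * n
      core-< x∈ with ∈betaOf⇒entry d w core-length x∈
      ... | c , i , refl , i<n , c<d , _ = position-< c c<d i<n

      core-closed : Closed n B
      core-closed {x} m with ∈betaOf⇒entry d w core-length m
      ... | zero  , i , eq , i<n , _ , _ = contradiction i<n (≤⇒≯ (subst (n ≤_) eq (m≤m+n n x)))
      ... | suc c , i , eq , i<n , c<d , c<e = subst (_∈ B)
        (sym (+-cancelˡ-≡ n x (c * n + i) (trans eq (+-assoc n (c * n) i))))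
        (entry⇒∈betaOf d w c i (<-trans (n<1+n c) c<d) (<-trans (n<1+n c) c<e))

      core-positive : 0 ∉ B
      core-positive m = <-irrefl (sym (lowest adm)) (∈betaOf⇒< d w 0 0 core-length z<s m)

      -- Successors lie in adjacent residue classes, one of which is empty, except that the
      -- successor of an element of class n - 1 wraps around to class 0, which is empty as a₀ = 0.
      core-isolated : ∀ {x} → x ∈ B → suc x ∉ B
      core-isolated m m′ with ∈betaOf⇒entry d w core-length m
      ... | c , i , refl , i<n , _ , c<e with suc i ℕ.≟ n
      ...   | yes eq = <-irrefl (sym (lowest adm)) (≤-<-trans z≤n (∈betaOf⇒< d w (suc c) 0 core-length z<s
              (subst (_∈ B) (trans (sym (+-suc (c * n) i)) (trans (cong (c * n +_) eq)
                (trans (+-comm (c * n) n) (sym (+-identityʳ (n + c * n)))))) m′)))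
      ...   | no neq with isolated adm i
      ...     | inj₁ e≡0 = contradiction (subst (c <_) e≡0 c<e) λ ()
      ...     | inj₂ e≡0 = contradiction (subst (c <_) e≡0 (∈betaOf⇒< d w c (suc i) core-length (≤∧≢⇒< i<n neq)
                (subst (_∈ B) (sym (+-suc (c * n) i)) m′))) λ ()

      core-InC : Closed t B → InC n t p
      core-InC closed = distinct , closed⇒core p-decreasing (subst (Closed n) (sym β≡) core-closed)
                                 , closed⇒core p-decreasing (subst (Closed t) (sym β≡) closed)
        where
        β≡ : beta p ≡ B
        β≡ = beta-partitionOf d core-length
        distinct : DistinctParts p
        distinct = distinctParts (subst Decreasing (sym β≡) (betaOf-decreasing d core-length))
          (λ {x} m m′ → core-isolated (subst (x ∈_) β≡ m) (subst (suc x ∈_) β≡ m′))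
          (λ m → core-positive (subst (0 ∈_) β≡ m))
        p-decreasing : Decreasing p
        p-decreasing = Linked⇒Decreasing (proj₁ distinct)

    module _ {p} (p∈ : InC n t p) where
      private
        p-decreasing : Decreasing p
        p-decreasing = Linked⇒Decreasing (proj₁ (proj₁ p∈))
        B = beta p

      InC-positive : 0 ∉ B
      InC-positive = beta-positive (proj₂ (proj₁ p∈))

      InC-isolated : ∀ {x} → x ∈ B → suc x ∉ B
      InC-isolated = beta-no-consecutive p-decreasing

      InC-closedⁿ : Closed n B
      InC-closedⁿ = core⇒closed z<s p-decreasing (proj₁ (proj₂ p∈))

      InC-closedᵗ : Closed t B
      InC-closedᵗ = core⇒closed 0<t p-decreasing (proj₂ (proj₂ p∈))

      -- The two bounds are where the moduli dn + 1 and dn - 1 differ. Given them, closure under n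
      -- makes each residue class an initial segment, so its cardinality determines it and the word
      -- recovers the beta-set.
      InC-∈cores : (∀ {x} → x ∈ B → x < d * n) → (∀ {c} → c * n + j ∈ B → c < h) → p ∈ cores
      InC-∈cores x<dn c<h = subst (_∈ cores) (trans (cong unbeta (sym β≡)) (unbeta-beta p)) (∈-map⁺ (partitionOf n d) w∈)
        where
        member? : ∀ i → Decidable (λ c → c * n + i ∈ B)
        member? i c = (c * n + i) ∈? B
        a : ℕ → ℕ
        a i = firstFailure (member? i) d
        a⇒ : ∀ i {c} → c < a i → c * n + i ∈ B
        a⇒ i = <firstFailure⇒ (member? i) d
        ⇒a : ∀ i {c} → c < d → c * n + i ∈ B → c < a i
        ⇒a i = ⇒<firstFailure (member? i) d (λ {c} m → InC-closedⁿ (subst (_∈ B) (+-assoc n (c * n) i) m))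
        a-lowest : a 0 ≡ 0
        a-lowest = n≤0⇒n≡0 (≮⇒≥ (λ 0<a → InC-positive (a⇒ 0 0<a)))
        a-isolated : ∀ i → a i ≡ 0 ⊎ a (suc i) ≡ 0
        a-isolated i with a i ℕ.≟ 0 | a (suc i) ℕ.≟ 0
        ... | yes eq | _      = inj₁ eq
        ... | no  _  | yes eq = inj₂ eq
        ... | no  ≢₀ | no ≢₁  = contradiction (a⇒ (suc i) (n≢0⇒n>0 ≢₁)) (InC-isolated (a⇒ i (n≢0⇒n>0 ≢₀)))
        a≤h : a j ≤ h
        a≤h = ≮⇒≥ λ h<a → <-irrefl refl (c<h (a⇒ j h<a))
        w = wordOf a n
        w∈ : w ∈ allWords
        w∈ = wordOf∈headBounded a (λ i → firstFailure≤ (member? i) d) a-lowest a-isolated j a≤h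
        β≡ : beta p ≡ betaOf n d w
        β≡ = Decreasing-ext (beta-decreasing p-decreasing) (betaOf-decreasing d (length-wordOf a n)) ⊆ ⊇
          where
          ⊆ : ∀ {x} → x ∈ B → x ∈ betaOf n d w
          ⊆ {x} m = subst (_∈ betaOf n d w) (sym x≡) (entry⇒∈betaOf d w (x / n) (x % n) c<d
            (subst (x / n <_) (sym (entry-wordOf a n (m%n<n x n))) (⇒a (x % n) c<d (subst (_∈ B) x≡ m))))
            where
            x≡ : x ≡ (x / n) * n + x % n
            x≡ = trans (m≡m%n+[m/n]*n x n) (+-comm (x % n) ((x / n) * n))
            c<d : x / n < d
            c<d = m<n*o⇒m/o<n (x<dn m)
          ⊇ : ∀ {x} → x ∈ betaOf n d w → x ∈ B
          ⊇ m with ∈betaOf⇒entry d w (length-wordOf a n) m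
          ... | c , i , refl , i<n , c<d , c<e = a⇒ i (subst (c <_) (entry-wordOf a n i<n) c<e)

    partitionOf-injective : ∀ {v w} → v ∈ allWords → w ∈ allWords → partitionOf n d v ≡ partitionOf n d w → v ≡ w
    partitionOf-injective v∈ w∈ eq = betaOf-injective d (core-length v∈) (core-length w∈) (core-bounded v∈) (core-bounded w∈)
      (trans (sym (beta-partitionOf d (core-length v∈))) (trans (cong beta eq) (beta-partitionOf d (core-length w∈))))

    cores-unique : Unique cores
    cores-unique = map-unique allWords partitionOf-injective (headBounded-unique h d j)

-- The moduli dn + 1 and dn - 1.

module Families where
  open BetaSets
  open Hooks
  open Words
  open Abacus
  open Classification

  module PlusOne (e j : ℕ) where
    d = suc e
    n = suc j
    open Cores d j (d * n + 1) d z<s ≤-refl (m≤n+m 1 (d * n)) public hiding (n)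

    ∈cores⇒InC : ∀ {p} → p ∈ cores → InC n (d * n + 1) p
    ∈cores⇒InC p∈ with ∈-map⁻ (partitionOf n d) p∈
    -- Closure under dn + 1 is vacuous: all elements are below dn.
    ... | w , w∈ , refl = core-InC w∈ λ m → contradiction (core-< w∈ m)
      (≤⇒≯ (≤-trans (m≤m+n (d * n) 1) (m≤m+n (d * n + 1) _)))

    -- An element dn + y would give y by closure under n and y - 1 by closure under dn + 1, two
    -- consecutive numbers; for y = 0 it would give 0.
    InC⇒∈cores : ∀ {p} → InC n (d * n + 1) p → p ∈ cores
    InC⇒∈cores {p} p∈ = InC-∈cores p∈ x<dn λ {c} m → *-cancelʳ-< n c d (≤-<-trans (m≤m+n (c * n) j) (x<dn m))
      where
      impossible : ∀ y → d * n + y ∉ beta p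
      impossible zero    m = InC-positive p∈ (Closed-multiple (InC-closedⁿ p∈) d m)
      impossible (suc y) m = InC-isolated p∈
        (InC-closedᵗ p∈ (subst (_∈ beta p) (sym (+-assoc (d * n) 1 y)) m))
        (Closed-multiple (InC-closedⁿ p∈) d m)
      x<dn : ∀ {x} → x ∈ beta p → x < d * n
      x<dn {x} m = ≰⇒> λ dn≤x → impossible (x ∸ d * n) (subst (_∈ beta p) (sym (m+[n∸m]≡n dn≤x)) m)

  module MinusOne (e j : ℕ) (1<dn : 1 < suc e * suc j) where
    d = suc e
    n = suc j
    t = d * n ∸ 1
    private
      0<t : 0 < t
      0<t = m<n⇒0<n∸m 1<dn
      -- The modulus dn - 1 is the d-th element of residue class n - 1. Excluding it amounts to
      -- a_{n-1} < d.
      last : e * n + j ≡ t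
      last = +-comm (e * n) j
    open Cores d j t e z<s (n≤1+n e) 0<t public hiding (n)

    ∈cores⇒InC : ∀ {p} → p ∈ cores → InC n t p
    ∈cores⇒InC p∈ with ∈-map⁻ (partitionOf n d) p∈
    ... | w , w∈ , refl = core-InC w∈ closed
      where
      closed : Closed t (betaOf n d w)
      -- Only t + 0 needs the bound on the leading entry; larger arguments give numbers from dn on.
      closed {zero}  m = contradiction (core-head w∈) (<⇒≱ (∈betaOf⇒< d w e j (core-length w∈) (n<1+n j)
        (subst (_∈ betaOf n d w) (trans (+-identityʳ t) (sym last)) m)))
      closed {suc x} m = contradiction (core-< w∈ m) (≤⇒≯ (≤-trans (m≤m+n (d * n) x) (≤-reflexive (sym (+-suc t x)))))

    -- Here dn + y would give both y and y + 1. The element dn - 1 would give 0 by closure, which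
    -- bounds class n - 1 by d - 1 elements.
    InC⇒∈cores : ∀ {p} → InC n t p → p ∈ cores
    InC⇒∈cores {p} p∈ = InC-∈cores p∈ x<dn λ {c} m → ≤∧≢⇒<
      (≤-pred (*-cancelʳ-< n c d (≤-<-trans (m≤m+n (c * n) j) (x<dn m))))
      λ { refl → InC-positive p∈ (InC-closedᵗ p∈ (subst (_∈ beta p) (trans last (sym (+-identityʳ t))) m)) }
      where
      impossible : ∀ y → d * n + y ∉ beta p
      impossible y m = InC-isolated p∈ (Closed-multiple (InC-closedⁿ p∈) d m)
        (InC-closedᵗ p∈ (subst (_∈ beta p) (sym (+-suc t y)) m))
      x<dn : ∀ {x} → x ∈ beta p → x < d * n
      x<dn {x} m = ≰⇒> λ dn≤x → impossible (x ∸ d * n) (subst (_∈ beta p) (sym (m+[n∸m]≡n dn≤x)) m)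

-- Power sums of sizes as word sums, and the shape of the final formula.

module Moments where
  open ℚ-Solver using (solve; _:=_; _:+_; _:-_; con)
  open RationalFunctions
  open QuasiPolynomials
  open Binomials
  open Conversion
  open Statistics
  open Words
  open WordSums
  open Classification

  toℚ-C-2 : ∀ z → toℚ (z C 2) ≡ ½ ℚ.* (toℚ z ℚ.* (toℚ z ℚ.- 1ℚ))
  toℚ-C-2 z = trans (sym (binom≡ z 2)) (trans (binom-next z 1)
    -- Here `suc⁻¹ 1` evaluates to `½`.
    (cong (½ ℚ.*_) (trans (cong ((toℚ z ℚ.- 1ℚ) ℚ.*_) (binom-1 z)) (ℚₚ.*-comm (toℚ z ℚ.- 1ℚ) (toℚ z)))))

  sizeOf-state : ∀ {d n w} → Admissible d n w → toℚ (size (partitionOf n d w)) ≡ sizeOf (state (suc n) w)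
  sizeOf-state {d} {n} {w} adm = begin
    s
      ≡⟨ solve 2 (λ s c → s := s :+ c :- c) refl s (toℚ (sum w C 2)) ⟩
    s ℚ.+ toℚ (sum w C 2) ℚ.- toℚ (sum w C 2)
      ≡⟨ cong₂ ℚ._-_ (trans (sym (toℚ-+ (size (partitionOf n d w)) (sum w C 2)))
           (trans (cong toℚ (sym (size-partitionOf adm))) (trans (toℚ-+ (momentOf w) (n * pairsOf w))
             (cong (toℚ (momentOf w) ℚ.+_) (toℚ-* n (pairsOf w)))))) (toℚ-C-2 (sum w)) ⟩
    toℚ (momentOf w) ℚ.+ toℚ n ℚ.* toℚ (pairsOf w) ℚ.- half
      ≡⟨ cong (λ i → toℚ (momentOf w) ℚ.+ i ℚ.* toℚ (pairsOf w) ℚ.- half)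
           (trans (solve 1 (λ i → i := con 1ℚ :+ i :- con 1ℚ) refl (toℚ n)) (cong (ℚ._- 1ℚ) (sym (toℚ-suc n)))) ⟩
    toℚ (momentOf w) ℚ.+ (toℚ (suc n) ℚ.- 1ℚ) ℚ.* toℚ (pairsOf w) ℚ.- half ∎
    where
    open ≡-Reasoning
    s    = toℚ (size (partitionOf n d w))
    half = ½ ℚ.* (toℚ (sum w) ℚ.* (toℚ (sum w) ℚ.- 1ℚ))

  toℚ-sum : ∀ {A : Set} (f : A → ℕ) xs → toℚ (sum (map f xs)) ≡ sumOver xs (λ x → toℚ (f x))
  toℚ-sum f []       = refl
  toℚ-sum f (x ∷ xs) = trans (toℚ-+ (f x) (sum (map f xs))) (cong (toℚ (f x) ℚ.+_) (toℚ-sum f xs))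

  sizePower : ℕ → Statistic
  sizePower k _ s = power (sizeOf s) k

  sumPow-cores : ∀ k h e j → h e ≤ suc e →
    toℚ (sumPow k (map (partitionOf (suc j) (suc e)) (headBounded (h e) (suc e) j))) ≡ boundedSum h (sizePower k) e j
  sumPow-cores k h e j h≤d = trans (toℚ-sum (λ p → size p ℕ.^ k) (map (partitionOf (suc j) (suc e)) W))
    (trans (sumOver-map (partitionOf (suc j) (suc e)) W (λ p → toℚ (size p ℕ.^ k)))
      (sumOver-cong (All.tabulate λ {w} w∈ → trans (toℚ-^ (size (partitionOf (suc j) (suc e) w)) k)
        (cong (λ q → power q k) (sizeOf-state (proj₁ (headBounded-admissible (suc e) j h≤d w∈)))))))
    where W = headBounded (h e) (suc e) j

  -- The claim about the value is an arbitrary predicate P, so one extraction of coefficients serves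
  -- both families, including the side condition 1 < dn of the second.
  Quasi-formula : ∀ {m f} → Quasi m f → (P : ℕ → ℕ → ℚ → Set) → (∀ e j → P (suc j) (suc e) (f e j)) →
    Σ (PolyRF m) λ A → Σ (PolyRF m) λ B →
    Σ ((d : ℕ) → 1 ≤ d → AllDefinedAt (toℚ d) A) λ defA →
    Σ ((d : ℕ) → 1 ≤ d → AllDefinedAt (toℚ d) B) λ defB →
    (n d : ℕ) (hn : 1 ≤ n) (hd : 1 ≤ d) →
      P n d (evalPolyRF A (toℚ n) (toℚ d) (defA d hd) ℚ.* toℚ (M d n)
             ℚ.+ evalPolyRF B (toℚ n) (toℚ d) (defB d hd) ℚ.* toℚ (M d (1 + n)))
  Quasi-formula {m} {f} h P holds =
    coefficients polyA , coefficients polyB , definedA , definedB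
    , λ { (suc j) (suc e) _ _ → subst (P (suc j) (suc e)) (value≡ e j) (holds e j) }
    where
    final = Quasi-final h
    polyA = proj₁ (proj₂ (proj₂ final))
    polyB = proj₁ (proj₂ (proj₂ (proj₂ final)))
    definedA : ∀ d → 1 ≤ d → AllDefinedAt (toℚ d) (coefficients polyA)
    definedA (suc e) _ = coefficients-defined polyA e
    definedB : ∀ d → 1 ≤ d → AllDefinedAt (toℚ d) (coefficients polyB)
    definedB (suc e) _ = coefficients-defined polyB e
    value≡ : ∀ e j → f e j ≡
      evalPolyRF (coefficients polyA) (toℚ (suc j)) (toℚ (suc e)) (coefficients-defined polyA e) ℚ.* toℚ (M (suc e) (suc j))
      ℚ.+ evalPolyRF (coefficients polyB) (toℚ (suc j)) (toℚ (suc e)) (coefficients-defined polyB e) ℚ.* toℚ (M (suc e) (suc (suc j)))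
    value≡ e j = trans (proj₂ (proj₂ (proj₂ (proj₂ final))) e j)
      (combine (toℚ (M (suc e) (suc j))) (toℚ (M (suc e) (suc (suc j)))) (coefficients-value polyA e j) (coefficients-value polyB e j))
      where
      combine : ∀ {a a′ b b′} x y → a ≡ a′ → b ≡ b′ → a ℚ.* x ℚ.+ b ℚ.* y ≡ a′ ℚ.* x ℚ.+ b′ ℚ.* y
      combine x y refl refl = refl

-- The theorem for both families.

open RationalFunctions using (Rational-d; Rational-cong; Rational-minus; Rational-const)
open WordSums using (Quasi-boundedSum; Weighted-sizePower)
open Families
open Moments

theorem1p5 : (k : ℕ) → 1 ≤ k →
    (Σ (PolyRF (1 + 2 * k)) λ A → Σ (PolyRF (1 + 2 * k)) λ B →
      Σ ((d : ℕ) → 1 ≤ d → AllDefinedAt (toℚ d) A) λ defA →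
      Σ ((d : ℕ) → 1 ≤ d → AllDefinedAt (toℚ d) B) λ defB →
      (n d : ℕ) (hn : 1 ≤ n) (hd : 1 ≤ d) →
        ∃ λ (L : List (List ℕ)) → Unique L
          × ((p : List ℕ) → (p ∈ L) ⇔ InC n (d * n + 1) p)
          × toℚ (sumPow k L)
            ≡ evalPolyRF A (toℚ n) (toℚ d) (defA d hd) ℚ.* toℚ (M d n)
              ℚ.+ evalPolyRF B (toℚ n) (toℚ d) (defB d hd) ℚ.* toℚ (M d (1 + n)))
    ×
    (Σ (PolyRF (1 + 2 * k)) λ A′ → Σ (PolyRF (1 + 2 * k)) λ B′ →
      Σ ((d : ℕ) → 1 ≤ d → AllDefinedAt (toℚ d) A′) λ defA′ →
      Σ ((d : ℕ) → 1 ≤ d → AllDefinedAt (toℚ d) B′) λ defB′ →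
      (n d : ℕ) (hn : 1 ≤ n) (hd : 1 ≤ d) → 1 < d * n →
        ∃ λ (L : List (List ℕ)) → Unique L
          × ((p : List ℕ) → (p ∈ L) ⇔ InC n (d * n ∸ 1) p)
          × toℚ (sumPow k L)
            ≡ evalPolyRF A′ (toℚ n) (toℚ d) (defA′ d hd) ℚ.* toℚ (M d n)
              ℚ.+ evalPolyRF B′ (toℚ n) (toℚ d) (defB′ d hd) ℚ.* toℚ (M d (1 + n)))
theorem1p5 k _ =
  Quasi-formula (Quasi-boundedSum suc Rational-d (Weighted-sizePower k))
    (λ n d q → ∃ λ L → Unique L × ((p : List ℕ) → (p ∈ L) ⇔ InC n (d * n + 1) p) × toℚ (sumPow k L) ≡ q)
    (λ e j → let open PlusOne e j using (cores; cores-unique; ∈cores⇒InC; InC⇒∈cores) in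
      cores , cores-unique , (λ p → mk⇔ ∈cores⇒InC InC⇒∈cores) , sumPow-cores k suc e j ≤-refl)
  -- With d = `suc e`, the bound d - 1 on the leading entry is e.
  , Quasi-formula (Quasi-boundedSum (λ e → e) Rational-pred-d (Weighted-sizePower k))
    (λ n d q → 1 < d * n → ∃ λ L → Unique L × ((p : List ℕ) → (p ∈ L) ⇔ InC n (d * n ∸ 1) p) × toℚ (sumPow k L) ≡ q)
    (λ e j 1<dn → let open MinusOne e j 1<dn using (cores; cores-unique; ∈cores⇒InC; InC⇒∈cores) in
      cores , cores-unique , (λ p → mk⇔ ∈cores⇒InC InC⇒∈cores) , sumPow-cores k (λ e → e) e j (n≤1+n e))
  where
  open ℚ-Solver using (solve; _:=_; _:+_; _:-_; con)
  Rational-pred-d : RationalFunctions.Rational (λ e → toℚ e)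
  Rational-pred-d = Rational-cong
    (λ e → trans (solve 1 (λ x → x := con 1ℚ :+ x :- con 1ℚ) refl (toℚ e)) (cong (ℚ._- 1ℚ) (sym (toℚ-suc e))))
    (Rational-minus Rational-d (Rational-const 1ℚ))
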